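{- Let $n$ be a positive integer, let $x,y,z$ be complex numbers with $x+y+z=1$, and let $t$ be an indeterminate (the identities below are identities of rational functions in $t$; equivalently they hold for every complex $t$ at which all denominators are nonzero). Then $$\frac{(-1)^n}2\sum_{k=0}^{n-1}\binom t{k}E_k(x)E_{n-1-k}(y)=\frac 1{n-t}\sum_{k=0}^n\binom {n-t}kB_k(x)E_{n-k}(z)+\binom tn\sum_{k=0}^n\binom nk\frac {E_{k}(z)}{t-k}B_{n-k}(y),$$ $$\frac n2\binom tn\sum_{k=0}^{n-1}\binom {n-1}k\frac {E_{k}(x)}{t-k}E_{n-1-k}(y)-(-1)^nE_n(z)\binom tn\sum_{k=0}^{n-1}\frac1{t-k}=(-1)^n\sum_{k=1}^n\binom t{n-k}\frac {B_k(y)}{k}E_{n-k}(z)-\sum_{k=1}^n\binom {n-1-t}{n-k}\frac {B_k(x)}kE_{n-k}(z),$$ and $$\frac {(-1)^{n-1}}n\binom {t-1}{n-1}\sum_{k=0}^n\binom nk\frac {B_k(x)}{t-k}B_{n-k}(y)-\frac {B_n(z)}n\binom {t-1}{n-1}\sum_{k=1}^{n-1}\frac1{t-k}=\frac 1t\sum_{k=1}^{n}\binom t{n-k}\frac{B_{k}(y)}kB_{n-k}(z)+\frac {(-1)^n}{n-t}\sum_{k=1}^n\binom {n-t}{n-k}\frac{B_k(x)}kB_{n-k}(z).$$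
   Context: Bernoulli numbers: $B_0=1$ and $\sum_{k=0}^n\binom{n+1}kB_k=0$ for $n\ge1$. Euler numbers: $E_0=1$ and $\sum_{0\le k\le n,\ 2\mid n-k}\binom nkE_k=0$ for $n\ge1$. Bernoulli polynomials $B_n(x)=\sum_{k=0}^n\binom nkB_kx^{n-k}$; Euler polynomials $E_n(x)=\sum_{k=0}^n\binom nk\frac{E_k}{2^k}(x-\tfrac12)^{n-k}$. For $z$ and integer $k\ge0$, $\binom zk=z(z-1)\cdots(z-k+1)/k!$ (with $\binom z0=1$). -}

module Defs where

open import Level using (Level; _⊔_) renaming (suc to lsuc)
open import Data.Nat using (ℕ; zero; suc; _∸_; _≤?_; _!)
open import Data.Nat.Combinatorics using (_C_)
open import Data.Bool using (Bool; true; false; if_then_else_)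
open import Relation.Nullary using (¬_; yes; no)
open import Algebra.Bundles using (CommutativeRing)

natCast : {c ℓ : Level} (R : CommutativeRing c ℓ) → ℕ → CommutativeRing.Carrier R
natCast R zero = CommutativeRing.0# R
natCast R (suc n) = CommutativeRing._+_ R (CommutativeRing.1# R) (natCast R n)

-- A field of characteristic zero (ℂ is the intended instance).
-- The multiplicative inverse is a total operation, only constrained on
-- nonzero elements (its value at 0# is irrelevant).
record CharZeroField (c ℓ : Level) : Set (lsuc (c ⊔ ℓ)) where
  infix 8 _⁻¹
  field
    commutativeRing : CommutativeRing c ℓ
  open CommutativeRing commutativeRing public
  field
    _⁻¹ : Carrier → Carrier
    ⁻¹-inverse : ∀ x → ¬ (x ≈ 0#) → x * x ⁻¹ ≈ 1#
    charZero : ∀ n → ¬ (natCast commutativeRing (suc n) ≈ 0#)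

  ι : ℕ → Carrier
  ι = natCast commutativeRing


module FieldDefs {c ℓ : Level} (F : CharZeroField c ℓ) where
  open CharZeroField F

  infixl 6 _−_
  _−_ : Carrier → Carrier → Carrier
  a − b = a + (- b)

  pow : Carrier → ℕ → Carrier
  pow a zero = 1#
  pow a (suc n) = a * pow a n

  sign : ℕ → Carrier
  sign n = pow (- 1#) n

  ½ : Carrier
  ½ = (ι 2) ⁻¹

  -- ∑ a b f = f a + f (a+1) + ... + f b   (empty, i.e. 0#, if b < a)
  sumCount : ℕ → ℕ → (ℕ → Carrier) → Carrier
  sumCount a zero f = 0#
  sumCount a (suc m) f = f a + sumCount (suc a) m f

  ∑ : ℕ → ℕ → (ℕ → Carrier) → Carrier
  ∑ a b f = sumCount a (suc b ∸ a) f

  syntax ∑ a b (λ k → e) = ∑[ k ∈ a ⋯ b ] e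

  falling : Carrier → ℕ → Carrier
  falling z zero = 1#
  falling z (suc k) = falling z k * (z − ι k)

  binom : Carrier → ℕ → Carrier
  binom z k = falling z k * (ι (k !)) ⁻¹

  choose : ℕ → ℕ → Carrier
  choose n k = ι (n C k)

  isEven : ℕ → Bool
  isEven zero = true
  isEven (suc zero) = false
  isEven (suc (suc n)) = isEven n

  -- bernTab n k = B_k for k ≤ n.
  -- B_0 = 1, and for m ≥ 1:  B_m = -(1/(m+1)) ∑_{k<m} C(m+1,k) B_k,
  -- i.e. ∑_{k=0}^m C(m+1,k) B_k = 0.
  bernTab : ℕ → ℕ → Carrier
  bernTab zero k = 1#
  bernTab (suc n) k with k ≤? n
  ... | yes _ = bernTab n k
  ... | no _ = - ((ι (suc (suc n))) ⁻¹ * (∑[ j ∈ 0 ⋯ n ] (choose (suc (suc n)) j * bernTab n j)))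

  bernoulli : ℕ → Carrier
  bernoulli n = bernTab n n

  -- eulTab n k = E_k for k ≤ n.
  -- E_0 = 1, and for m ≥ 1:  E_m = - ∑_{k<m, 2 ∣ m-k} C(m,k) E_k,
  -- i.e. ∑_{0≤k≤m, 2∣m-k} C(m,k) E_k = 0.
  eulTab : ℕ → ℕ → Carrier
  eulTab zero k = 1#
  eulTab (suc n) k with k ≤? n
  ... | yes _ = eulTab n k
  ... | no _ = - (∑[ j ∈ 0 ⋯ n ] (if isEven (suc n ∸ j) then choose (suc n) j * eulTab n j else 0#))

  euler : ℕ → Carrier
  euler n = eulTab n n

  bernoulliPoly : ℕ → Carrier → Carrier
  bernoulliPoly n x = ∑[ k ∈ 0 ⋯ n ] (choose n k * bernoulli k * pow x (n ∸ k))

  eulerPoly : ℕ → Carrier → Carrier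
  eulerPoly n x = ∑[ k ∈ 0 ⋯ n ] (choose n k * (euler k * (pow (ι 2) k) ⁻¹) * pow (x − ½) (n ∸ k))

module Submission where

open import Defs
open import Level using (Level)
open import Algebra.Bundles using (CommutativeRing)
open import Algebra.Morphism.Structures using (IsRingHomomorphism)
open import Data.Bool using (true; false; if_then_else_)
open import Data.Integer as ℤ using (ℤ; +_; -[1+_]; _⊖_; _◃_; +[1+_])
open import Data.Maybe using (Maybe; just; nothing)
open import Data.Nat as ℕ using (ℕ; zero; suc; _!; _∸_; _≤_; _<_; _≤?_; z≤n; s≤s)
open import Data.Nat.Combinatorics using (_C_; nCk≡n!/k![n-k]!; nCk≡nC[n∸k]; nC1≡n; nCn≡1; k![n∸k]!∣n!)
open import Data.Product using (_×_; _,_)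
import Data.Sign as Sign
open import Data.Sum using (inj₁; inj₂)
open import Function using (id)
open import Relation.Binary.PropositionalEquality as ≡ using (_≡_)
open import Relation.Nullary using (¬_; yes; no; contradiction)
import Algebra.Morphism.Construct.Identity as Identity
import Algebra.Properties.CommutativeSemiring.Exp as Exponentiation
import Algebra.Properties.Ring as RingProperties
import Algebra.Properties.Semiring.Mult.TCOptimised as Multiples
import Algebra.Solver.Ring as RingSolver
import Algebra.Solver.Ring.AlmostCommutativeRing as ACR
import Data.Integer.Properties as ℤ
import Data.Nat.DivMod as ℕ
import Data.Nat.Properties as ℕ

-- Put B(u,x) = Σ Bₙ(x) uⁿTⁿ/n!, E(u,x) = Σ Eₙ(x) uⁿTⁿ/n! and w = u − v.  Then
--
--   w B(u,x) B(v,y)      = u B(w,x) B(v,x+y) − v B(w,1−y) B(u,x+y),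
--   ½ w T E(u,x) E(v,y)  = B(w,1−y) E(u,x+y) − B(w,x) E(v,x+y),
--
-- which are partial fraction identities in e^{uT} and e^{vT}.  They are homogeneous in u and v,
-- so nothing is lost by setting v = 1.  Applying to the coefficient of Tⁿ the linear functional
-- uⁱ ↦ l i turns wᵏuᵃ into the k-th finite difference of l at a, and the reflection
-- Bₙ(1−z) = (−1)ⁿBₙ(z) replaces x + y by z.  The first identity of the theorem is the case
-- l i = t(t−1)⋯(t−i+1) (n−i)!, and the other two are the case where l i is a constant multiple
-- of Σ_{j<i} 1/(t−j), up to an additive constant; the differences of both have closed forms.

-- The functional is dictated by the left-hand sides. A coefficient in T there is w times a sum of
-- multiples of uᵏ, and w uᵏ goes to l(k+1) - l(k); the weights 1/(t-k) therefore force l to be a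
-- sequence of partial sums. The additive constant is then chosen to remove the term k = 0 from one
-- of the two sums on the right. In the other sum that term, the only one to contain l itself and
-- not a difference of it, produces Σ 1/(t-k) next to E_n(z) or B_n(z). For u to be free, the
-- generating functions are series in T whose coefficients are power series in X, with u = X. As X
-- is not invertible, division by u is impossible: (e^{uT} - 1)/(uT) and its inverse are obtained by
-- substituting uT into fixed series. All this is set up over a ring K with a homomorphism φ : F →
-- K, and used both for K = F, where the polynomials are defined, and for K = F[[X]]. Polynomials in
-- u are represented by power series, so the functional is truncated at a degree that must exceed
-- every power that occurs.

module IntegerSolver {c ℓ : Level} (R : CommutativeRing c ℓ) where
  open CommutativeRing R
  open RingProperties ring
  open Multiples semiring renaming (_×_ to _·_)
  open import Relation.Binary.Reasoning.Setoid setoid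

  -- Coefficients are integers because the solver has to decide their equality, which an arbitrary
  -- carrier does not offer. With the optimised multiples `1 · 1#` reduces to `1#`, so `:1` denotes
  -- `1#` itself.
  ⟦_⟧ℤ : ℤ → Carrier
  ⟦ + n ⟧ℤ = n · 1#
  ⟦ -[1+ n ] ⟧ℤ = - (suc n · 1#)

  cancelled-sum : ∀ a b e → (e + a) - (e + b) ≈ a - b
  cancelled-sum a b e = begin
    (e + a) + - (e + b)     ≈⟨ +-cong (+-comm e a) (sym (-‿+-comm e b)) ⟩
    (a + e) + (- e + - b)   ≈⟨ +-assoc a e _ ⟩
    a + (e + (- e + - b))   ≈⟨ +-congˡ (sym (+-assoc e (- e) (- b))) ⟩
    a + ((e + - e) + - b)   ≈⟨ +-congˡ (+-congʳ (-‿inverseʳ e)) ⟩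
    a + (0# + - b)          ≈⟨ +-congˡ (+-identityˡ _) ⟩
    a + - b                 ∎

  ⊖-homo : ∀ m n → ⟦ m ⊖ n ⟧ℤ ≈ m · 1# - n · 1#
  ⊖-homo m zero = sym (trans (+-congˡ -0#≈0#) (+-identityʳ _))
  ⊖-homo zero (suc n) = sym (+-identityˡ _)
  ⊖-homo (suc m) (suc n) = begin
    ⟦ suc m ⊖ suc n ⟧ℤ                ≡⟨ ≡.cong ⟦_⟧ℤ (ℤ.[1+m]⊖[1+n]≡m⊖n m n) ⟩
    ⟦ m ⊖ n ⟧ℤ                        ≈⟨ ⊖-homo m n ⟩
    m · 1# - n · 1#                   ≈⟨ cancelled-sum _ _ 1# ⟨
    (1# + m · 1#) - (1# + n · 1#)     ≈⟨ +-cong (1+× m 1#) (-‿cong (1+× n 1#)) ⟨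
    suc m · 1# - suc n · 1#           ∎

  +-homoℤ : ∀ i j → ⟦ i ℤ.+ j ⟧ℤ ≈ ⟦ i ⟧ℤ + ⟦ j ⟧ℤ
  +-homoℤ (+ m) (+ n) = ×-homo-+ 1# m n
  +-homoℤ (+ m) -[1+ n ] = ⊖-homo m (suc n)
  +-homoℤ -[1+ m ] (+ n) = trans (⊖-homo n (suc m)) (+-comm _ _)
  +-homoℤ -[1+ m ] -[1+ n ] = begin
    - (suc (suc (m ℕ.+ n)) · 1#)        ≡⟨ ≡.cong (λ k → - (suc k · 1#)) (ℕ.+-suc m n) ⟨
    - ((suc m ℕ.+ suc n) · 1#)          ≈⟨ -‿cong (×-homo-+ 1# (suc m) (suc n)) ⟩
    - (suc m · 1# + suc n · 1#)         ≈⟨ -‿+-comm _ _ ⟨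
    - (suc m · 1#) + - (suc n · 1#)     ∎

  +◃-homo : ∀ n → ⟦ Sign.+ ◃ n ⟧ℤ ≈ n · 1#
  +◃-homo n = reflexive (≡.cong ⟦_⟧ℤ (ℤ.+◃n≡+n n))

  -◃-homo : ∀ n → ⟦ Sign.- ◃ n ⟧ℤ ≈ - (n · 1#)
  -◃-homo zero = sym -0#≈0#
  -◃-homo (suc n) = refl

  *-homoℤ : ∀ i j → ⟦ i ℤ.* j ⟧ℤ ≈ ⟦ i ⟧ℤ * ⟦ j ⟧ℤ
  *-homoℤ (+ m) (+ n) = trans (+◃-homo (m ℕ.* n)) (×1-homo-* m n)
  *-homoℤ (+ m) -[1+ n ] = begin
    ⟦ Sign.- ◃ (m ℕ.* suc n) ⟧ℤ     ≈⟨ -◃-homo (m ℕ.* suc n) ⟩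
    - ((m ℕ.* suc n) · 1#)          ≈⟨ -‿cong (×1-homo-* m (suc n)) ⟩
    - (m · 1# * suc n · 1#)         ≈⟨ -‿distribʳ-* _ _ ⟩
    m · 1# * - (suc n · 1#)         ∎
  *-homoℤ -[1+ m ] (+ n) = begin
    ⟦ Sign.- ◃ (suc m ℕ.* n) ⟧ℤ     ≈⟨ -◃-homo (suc m ℕ.* n) ⟩
    - ((suc m ℕ.* n) · 1#)          ≈⟨ -‿cong (×1-homo-* (suc m) n) ⟩
    - (suc m · 1# * n · 1#)         ≈⟨ -‿distribˡ-* _ _ ⟩
    - (suc m · 1#) * n · 1#         ∎
  *-homoℤ -[1+ m ] -[1+ n ] = begin
    (suc m ℕ.* suc n) · 1#                ≈⟨ ×1-homo-* (suc m) (suc n) ⟩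
    suc m · 1# * suc n · 1#               ≈⟨ -‿involutive _ ⟨
    - - (suc m · 1# * suc n · 1#)         ≈⟨ -‿cong (-‿distribˡ-* _ _) ⟩
    - (- (suc m · 1#) * suc n · 1#)       ≈⟨ -‿distribʳ-* _ _ ⟩
    - (suc m · 1#) * - (suc n · 1#)       ∎

  -‿homoℤ : ∀ i → ⟦ ℤ.- i ⟧ℤ ≈ - ⟦ i ⟧ℤ
  -‿homoℤ (+ zero) = sym -0#≈0#
  -‿homoℤ +[1+ n ] = refl
  -‿homoℤ -[1+ n ] = sym (-‿involutive _)

  morphism : ℤ.+-*-rawRing ACR.-Raw-AlmostCommutative⟶ ACR.fromCommutativeRing R
  morphism = record
    { ⟦_⟧    = ⟦_⟧ℤ
    ; +-homo = +-homoℤ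
    ; *-homo = *-homoℤ
    ; -‿homo = -‿homoℤ
    ; 0-homo = refl
    ; 1-homo = refl
    }

  _≟ℤ_ : ∀ i j → Maybe (⟦ i ⟧ℤ ≈ ⟦ j ⟧ℤ)
  i ≟ℤ j with i ℤ.≟ j
  ... | yes i≡j = just (reflexive (≡.cong ⟦_⟧ℤ i≡j))
  ... | no _    = nothing

  open RingSolver ℤ.+-*-rawRing (ACR.fromCommutativeRing R) morphism _≟ℤ_ public
    using (Polynomial; solve; con; _:+_; _:*_; _:-_; :-_; _:=_)

  :0 :1 : ∀ {n} → Polynomial n
  :0 = con (+ 0)
  :1 = con (+ 1)

-- Formal power series over a commutative ring

module PowerSeries {c ℓ : Level} (R : CommutativeRing c ℓ) where
  open CommutativeRing R
  open RingProperties ring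
  open IntegerSolver R
  open import Relation.Binary.Reasoning.Setoid setoid

  Series : Set c
  Series = ℕ → Carrier

  infix 4 _≋_
  _≋_ : Series → Series → Set ℓ
  p ≋ q = ∀ n → p n ≈ q n

  tail : Series → Series
  tail p n = p (suc n)

  -- The antidiagonal sum over k + m = n. Handing both indices to the summand keeps truncated
  -- subtraction out of every convolution.
  anti : (n : ℕ) → (ℕ → ℕ → Carrier) → Carrier
  anti zero    f = f 0 0
  anti (suc n) f = f 0 (suc n) + anti n (λ k m → f (suc k) m)

  anti-cong : ∀ n {f g : ℕ → ℕ → Carrier} → (∀ k m → k ℕ.+ m ≡ n → f k m ≈ g k m) → anti n f ≈ anti n g
  anti-cong zero    f≈g = f≈g 0 0 ≡.refl
  anti-cong (suc n) f≈g = +-cong (f≈g 0 (suc n) ≡.refl) (anti-cong n λ k m e → f≈g (suc k) m (≡.cong suc e))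

  anti-+ : ∀ n (f g : ℕ → ℕ → Carrier) → anti n (λ k m → f k m + g k m) ≈ anti n f + anti n g
  anti-+ zero    f g = refl
  anti-+ (suc n) f g = trans (+-congˡ (anti-+ n _ _))
    (solve 4 (λ a b d e → (a :+ b) :+ (d :+ e) := (a :+ d) :+ (b :+ e)) refl _ _ _ _)

  anti-* : ∀ n a (f : ℕ → ℕ → Carrier) → anti n (λ k m → a * f k m) ≈ a * anti n f
  anti-* zero    a f = refl
  anti-* (suc n) a f = trans (+-congˡ (anti-* n a _)) (sym (distribˡ a _ _))

  anti-last : ∀ n (f : ℕ → ℕ → Carrier) → anti (suc n) f ≈ f (suc n) 0 + anti n (λ k m → f k (suc m))
  anti-last zero    f = +-comm _ _
  anti-last (suc n) f = trans (+-congˡ (anti-last n λ k m → f (suc k) m))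
    (solve 3 (λ a b d → a :+ (b :+ d) := b :+ (a :+ d)) refl _ _ _)

  anti-swap : ∀ n (f : ℕ → ℕ → Carrier) → anti n f ≈ anti n (λ k m → f m k)
  anti-swap zero    f = refl
  anti-swap (suc n) f = trans (+-congˡ (anti-swap n λ k m → f (suc k) m)) (sym (anti-last n λ k m → f m k))

  conv : Series → Series → Series
  conv p q n = anti n (λ k m → p k * q m)

  conv-cong : ∀ {p p′ q q′} → p ≋ p′ → q ≋ q′ → conv p q ≋ conv p′ q′
  conv-cong p≋ q≋ n = anti-cong n (λ k m _ → *-cong (p≋ k) (q≋ m))

  conv-comm : ∀ p q → conv p q ≋ conv q p
  conv-comm p q n = trans (anti-swap n _) (anti-cong n λ k m _ → *-comm _ _)

  conv-distribʳ : ∀ r p q → conv (λ n → p n + q n) r ≋ (λ n → conv p r n + conv q r n)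
  conv-distribʳ r p q n = trans (anti-cong n λ k m _ → distribʳ (r m) (p k) (q k)) (anti-+ n _ _)

  conv-scaleˡ : ∀ a p q → conv (λ n → a * p n) q ≋ (λ n → a * conv p q n)
  conv-scaleˡ a p q n = trans (anti-cong n λ k m _ → *-assoc a (p k) (q m)) (anti-* n a _)

  conv-assoc : ∀ p q r → conv (conv p q) r ≋ conv p (conv q r)
  conv-assoc p q r zero    = *-assoc _ _ _
  conv-assoc p q r (suc n) = begin
    p 0 * q 0 * r (suc n) + conv (λ m → p 0 * q (suc m) + conv (tail p) q m) r n
      ≈⟨ +-congˡ (conv-distribʳ r (λ m → p 0 * q (suc m)) (conv (tail p) q) n) ⟩
    p 0 * q 0 * r (suc n) + (conv (λ m → p 0 * q (suc m)) r n + conv (conv (tail p) q) r n)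
      ≈⟨ +-congˡ (+-cong (conv-scaleˡ (p 0) (tail q) r n) (conv-assoc (tail p) q r n)) ⟩
    p 0 * q 0 * r (suc n) + (p 0 * conv (tail q) r n + conv (tail p) (conv q r) n)
      ≈⟨ solve 5 (λ a b d e f → a :* b :* d :+ (a :* e :+ f) := a :* (b :* d :+ e) :+ f) refl _ _ _ _ _ ⟩
    p 0 * (q 0 * r (suc n) + conv (tail q) r n) + conv (tail p) (conv q r) n ∎

  const : Carrier → Series
  const a zero    = a
  const a (suc n) = 0#

  X : Series
  X zero    = 0#
  X (suc n) = const 1# n

  conv-zeroˡ : ∀ p → conv (λ _ → 0#) p ≋ λ _ → 0#
  conv-zeroˡ p zero    = zeroˡ _
  conv-zeroˡ p (suc n) = trans (+-cong (zeroˡ _) (conv-zeroˡ p n)) (+-identityˡ _)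

  const-conv : ∀ a p → conv (const a) p ≋ λ n → a * p n
  const-conv a p zero    = refl
  const-conv a p (suc n) = trans (+-congˡ (conv-zeroˡ p n)) (+-identityʳ _)

  X-conv : ∀ p n → conv X p (suc n) ≈ p n
  X-conv p n = begin
    0# * p (suc n) + conv (const 1#) p n   ≈⟨ +-cong (zeroˡ _) (const-conv 1# p n) ⟩
    0# + 1# * p n                          ≈⟨ trans (+-identityˡ _) (*-identityˡ _) ⟩
    p n                                    ∎

  conv-identityˡ : ∀ p → conv (const 1#) p ≋ p
  conv-identityˡ p n = trans (const-conv 1# p n) (*-identityˡ _)

  -- As a ring, series are open to the solver and to abstract arguments about inverses, and the
  -- construction can be iterated: series in T whose coefficients are series in X.
  seriesRing : CommutativeRing c ℓ
  seriesRing = record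
    { Carrier = Series
    ; _≈_ = _≋_
    ; _+_ = λ p q n → p n + q n
    ; _*_ = conv
    ; -_ = λ p n → - p n
    ; 0# = λ _ → 0#
    ; 1# = const 1#
    ; isCommutativeRing = record
      { isRing = record
        { +-isAbelianGroup = record
          { isGroup = record
            { isMonoid = record
              { isSemigroup = record
                { isMagma = record
                  { isEquivalence = record
                    { refl  = λ _ → refl
                    ; sym   = λ e n → sym (e n)
                    ; trans = λ e e′ n → trans (e n) (e′ n)
                    }
                  ; ∙-cong = λ e e′ n → +-cong (e n) (e′ n)
                  }
                ; assoc = λ p q r n → +-assoc (p n) (q n) (r n)
                }
              ; identity = (λ p n → +-identityˡ (p n)) , (λ p n → +-identityʳ (p n))
              }
            ; inverse = (λ p n → -‿inverseˡ (p n)) , (λ p n → -‿inverseʳ (p n))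
            ; ⁻¹-cong = λ e n → -‿cong (e n)
            }
          ; comm = λ p q n → +-comm (p n) (q n)
          }
        ; *-cong = conv-cong
        ; *-assoc = conv-assoc
        ; *-identity = conv-identityˡ , (λ p n → trans (conv-comm p (const 1#) n) (conv-identityˡ p n))
        ; distrib = (λ r p q n → trans (conv-comm r (λ m → p m + q m) n)
                                   (trans (conv-distribʳ r p q n) (+-cong (conv-comm p r n) (conv-comm q r n))))
                  , conv-distribʳ
        }
      ; *-comm = conv-comm
      }
    }

  -- This is the φ that makes the ring of series in X an algebra over the field.
  const-isRingHomomorphism : IsRingHomomorphism rawRing (CommutativeRing.rawRing seriesRing) const
  const-isRingHomomorphism = record
    { isSemiringHomomorphism = record
      { isNearSemiringHomomorphism = record
        { +-isMonoidHomomorphism = record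
          { isMagmaHomomorphism = record
            { isRelHomomorphism = record { cong = λ { a≈b zero → a≈b ; a≈b (suc n) → refl } }
            ; homo = λ { a b zero → refl ; a b (suc n) → sym (+-identityˡ 0#) }
            }
          ; ε-homo = λ { zero → refl ; (suc n) → refl }
          }
        ; *-homo = λ { a b zero → refl ; a b (suc n) → sym (trans (const-conv a (const b) (suc n)) (zeroʳ a)) }
        }
      ; 1#-homo = λ _ → refl
      }
    ; -‿homo = λ { a zero → refl ; a (suc n) → sym -0#≈0# }
    }

-- Casts, cancellation and reciprocal factorials in characteristic zero

module NatCast {c ℓ : Level} (R : CommutativeRing c ℓ) where
  open CommutativeRing R
  open IntegerSolver R

  natCast-+ : ∀ m n → natCast R (m ℕ.+ n) ≈ natCast R m + natCast R n
  natCast-+ zero    n = sym (+-identityˡ _)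
  natCast-+ (suc m) n = trans (+-congˡ (natCast-+ m n)) (sym (+-assoc _ _ _))

  natCast-* : ∀ m n → natCast R (m ℕ.* n) ≈ natCast R m * natCast R n
  natCast-* zero    n = sym (zeroˡ _)
  natCast-* (suc m) n = trans (natCast-+ n (m ℕ.* n)) (trans (+-congˡ (natCast-* m n))
    (solve 2 (λ a b → b :+ a :* b := (:1 :+ a) :* b) refl (natCast R m) (natCast R n)))

module CharZeroFieldProperties {c ℓ : Level} (F : CharZeroField c ℓ) where
  open CharZeroField F
  open IntegerSolver commutativeRing
  open NatCast commutativeRing public renaming (natCast-+ to ι-+; natCast-* to ι-*)
  open PowerSeries commutativeRing using (Series)
  open import Relation.Binary.Reasoning.Setoid setoid

  ι-nonZero : ∀ n .{{_ : ℕ.NonZero n}} → ¬ (ι n ≈ 0#)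
  ι-nonZero (suc n) = charZero n

  ι-! : ∀ n → ¬ (ι (n !) ≈ 0#)
  ι-! n = ι-nonZero (n !) {{n ℕ.!≢0}}

  -- Fractions are compared by clearing denominators and cancelling, since `_⁻¹` is specified by
  -- `⁻¹-inverse` alone.
  *-cancelˡ : ∀ {x a b} → ¬ (x ≈ 0#) → x * a ≈ x * b → a ≈ b
  *-cancelˡ {x} {a} {b} x≉0 xa≈xb = begin
    a                ≈⟨ undo a ⟨
    x ⁻¹ * (x * a)   ≈⟨ *-congˡ xa≈xb ⟩
    x ⁻¹ * (x * b)   ≈⟨ undo b ⟩
    b                ∎
    where
    undo : ∀ a → x ⁻¹ * (x * a) ≈ a
    undo a = begin
      x ⁻¹ * (x * a)   ≈⟨ solve 3 (λ y x a → y :* (x :* a) := (x :* y) :* a) refl _ _ _ ⟩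
      x * x ⁻¹ * a     ≈⟨ *-congʳ (⁻¹-inverse x x≉0) ⟩
      1# * a           ≈⟨ *-identityˡ a ⟩
      a                ∎

  invFact : Series
  invFact n = ι (n !) ⁻¹

  !-invFact : ∀ n → ι (n !) * invFact n ≈ 1#
  !-invFact n = ⁻¹-inverse _ (ι-! n)

  suc-invFact : ∀ n → ι (suc n) * invFact (suc n) ≈ invFact n
  suc-invFact n = *-cancelˡ (ι-! n) (begin
    ι (n !) * (ι (suc n) * invFact (suc n))
      ≈⟨ solve 3 (λ a b d → a :* (b :* d) := b :* a :* d) refl _ _ _ ⟩
    ι (suc n) * ι (n !) * invFact (suc n)   ≈⟨ *-congʳ (ι-* (suc n) (n !)) ⟨
    ι (suc n !) * invFact (suc n)           ≈⟨ !-invFact (suc n) ⟩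
    1#                                      ≈⟨ !-invFact n ⟨
    ι (n !) * invFact n                     ∎)

  invFact-0 : invFact 0 ≈ 1#
  invFact-0 = trans (sym (*-identityˡ _)) (trans (*-congʳ (sym (+-identityʳ 1#))) (!-invFact 0))

-- Exponential series over an algebra φ : F → K

module Exponential {c ℓ c′ ℓ′ : Level} (F : CharZeroField c ℓ) (K : CommutativeRing c′ ℓ′)
  (φ : CharZeroField.Carrier F → CommutativeRing.Carrier K)
  (φ-homo : IsRingHomomorphism (CharZeroField.rawRing F) (CommutativeRing.rawRing K) φ) where

  private
    module F = CharZeroField F
    module SF = PowerSeries F.commutativeRing
    module φ = IsRingHomomorphism φ-homo
  open CharZeroFieldProperties F using (invFact; suc-invFact; invFact-0)
  open Exponentiation F.commutativeSemiring using () renaming (_^_ to _^F_)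
  open CommutativeRing K
  open IntegerSolver K
  open PowerSeries K
  open NatCast K
  open Exponentiation commutativeSemiring
  open import Relation.Binary.Reasoning.Setoid setoid
  private module S = CommutativeRing seriesRing

  φ-natCast : ∀ n → φ (F.ι n) ≈ natCast K n
  φ-natCast zero    = φ.0#-homo
  φ-natCast (suc n) = trans (φ.+-homo _ _) (+-cong φ.1#-homo (φ-natCast n))

  φ-^ : ∀ x n → φ (x ^F n) ≈ φ x ^ n
  φ-^ x zero    = φ.1#-homo
  φ-^ x (suc n) = trans (φ.*-homo _ _) (*-congˡ (φ-^ x n))

  φ-anti : ∀ n f → φ (SF.anti n f) ≈ anti n (λ k m → φ (f k m))
  φ-anti zero    f = refl
  φ-anti (suc n) f = trans (φ.+-homo _ _) (+-congˡ (φ-anti n _))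

  -- K is only a ring, but the image of a nonzero field element is a unit in it.
  φ-cancelˡ : ∀ {x a b} → ¬ (x F.≈ F.0#) → φ x * a ≈ φ x * b → a ≈ b
  φ-cancelˡ {x} {a} {b} x≉0 xa≈xb = begin
    a                        ≈⟨ undo a ⟨
    φ (x F.⁻¹) * (φ x * a)   ≈⟨ *-congˡ xa≈xb ⟩
    φ (x F.⁻¹) * (φ x * b)   ≈⟨ undo b ⟩
    b                        ∎
    where
    undo : ∀ a → φ (x F.⁻¹) * (φ x * a) ≈ a
    undo a = begin
      φ (x F.⁻¹) * (φ x * a)   ≈⟨ solve 3 (λ y x a → y :* (x :* a) := (x :* y) :* a) refl _ _ _ ⟩
      φ x * φ (x F.⁻¹) * a     ≈⟨ *-congʳ (φ.*-homo _ _) ⟨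
      φ (x F.* x F.⁻¹) * a     ≈⟨ *-congʳ (φ.⟦⟧-cong (F.⁻¹-inverse x x≉0)) ⟩
      φ F.1# * a               ≈⟨ *-congʳ φ.1#-homo ⟩
      1# * a                   ≈⟨ *-identityˡ a ⟩
      a                        ∎

  -- p(T) ↦ p(wT)
  scale : Carrier → SF.Series → Series
  scale w p n = φ (p n) * w ^ n

  scale-cong : ∀ {w w′ p q} → w ≈ w′ → p SF.≋ q → scale w p ≋ scale w′ q
  scale-cong w≈ p≋q n = *-cong (φ.⟦⟧-cong (p≋q n)) (^-congˡ n w≈)

  scale-conv : ∀ w p q → scale w (SF.conv p q) ≋ conv (scale w p) (scale w q)
  scale-conv w p q n = begin
    φ (SF.conv p q n) * w ^ n                        ≈⟨ *-comm _ _ ⟩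
    w ^ n * φ (SF.conv p q n)                        ≈⟨ *-congˡ (φ-anti n _) ⟩
    w ^ n * anti n (λ k m → φ (p k F.* q m))         ≈⟨ anti-* n _ _ ⟨
    anti n (λ k m → w ^ n * φ (p k F.* q m))         ≈⟨ anti-cong n step ⟩
    conv (scale w p) (scale w q) n                   ∎
    where
    step : ∀ k m → k ℕ.+ m ≡ n → w ^ n * φ (p k F.* q m) ≈ φ (p k) * w ^ k * (φ (q m) * w ^ m)
    step k m ≡.refl = trans (*-cong (^-homo-* w k m) (φ.*-homo _ _))
      (solve 4 (λ a b x y → a :* b :* (x :* y) := x :* a :* (y :* b)) refl _ _ _ _)

  scale-const-1 : ∀ w → scale w (SF.const F.1#) ≋ const 1#
  scale-const-1 w zero    = trans (*-identityʳ _) φ.1#-homo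
  scale-const-1 w (suc n) = trans (*-congʳ φ.0#-homo) (zeroˡ _)

  -- The substitution T ↦ wT is multiplicative, so it carries inverse series to inverse series even
  -- when w is not a unit.
  scale-inverse : ∀ w p q → SF.conv p q SF.≋ SF.const F.1# → conv (scale w p) (scale w q) ≋ const 1#
  scale-inverse w p q pq≋1 n = trans (sym (scale-conv w p q n))
    (trans (scale-cong refl pq≋1 n) (scale-const-1 w n))

  exp : Carrier → Series
  exp c = scale c invFact

  exp-cong : ∀ {c d} → c ≈ d → exp c ≋ exp d
  exp-cong c≈d = scale-cong c≈d (λ _ → F.refl)

  exp-at-0 : ∀ c → exp c 0 ≈ 1#
  exp-at-0 c = trans (*-identityʳ _) (trans (φ.⟦⟧-cong invFact-0) φ.1#-homo)

  exp-0 : exp 0# ≋ const 1#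
  exp-0 zero    = exp-at-0 0#
  exp-0 (suc n) = trans (*-congˡ (zeroˡ _)) (zeroʳ _)

  -- The derivation T d/dT. Unlike d/dT it preserves degrees, so its Leibniz rule needs no index
  -- shift.
  θ : Series → Series
  θ p n = natCast K n * p n

  θ-conv : ∀ p q n → θ (conv p q) n ≈ conv (θ p) q n + conv p (θ q) n
  θ-conv p q n = begin
    natCast K n * conv p q n                              ≈⟨ anti-* n _ _ ⟨
    anti n (λ k m → natCast K n * (p k * q m))            ≈⟨ anti-cong n step ⟩
    anti n (λ k m → θ p k * q m + p k * θ q m)            ≈⟨ anti-+ n _ _ ⟩
    conv (θ p) q n + conv p (θ q) n                       ∎
    where
    step : ∀ k m → k ℕ.+ m ≡ n → natCast K n * (p k * q m) ≈ θ p k * q m + p k * θ q m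
    step k m ≡.refl = trans (*-congʳ (natCast-+ k m))
      (solve 4 (λ a b x y → (a :+ b) :* (x :* y) := a :* x :* y :+ x :* (b :* y)) refl _ _ _ _)

  θ-exp : ∀ c n → θ (exp c) (suc n) ≈ c * exp c n
  θ-exp c n = begin
    natCast K (suc n) * (φ (invFact (suc n)) * (c * c ^ n))
      ≈⟨ solve 4 (λ a b x y → a :* (b :* (x :* y)) := x :* (a :* b :* y)) refl (natCast K (suc n)) _ _ _ ⟩
    c * (natCast K (suc n) * φ (invFact (suc n)) * c ^ n)
      ≈⟨ *-congˡ (*-congʳ (*-congʳ (φ-natCast (suc n)))) ⟨
    c * (φ (F.ι (suc n)) * φ (invFact (suc n)) * c ^ n)
      ≈⟨ *-congˡ (*-congʳ (φ.*-homo _ _)) ⟨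
    c * (φ (F.ι (suc n) F.* invFact (suc n)) * c ^ n)
      ≈⟨ *-congˡ (*-congʳ (φ.⟦⟧-cong (suc-invFact n))) ⟩
    c * exp c n ∎

  θ-exp-conv : ∀ c p n → conv (θ (exp c)) p (suc n) ≈ c * conv (exp c) p n
  θ-exp-conv c p n = begin
    0# * exp c 0 * p (suc n) + conv (tail (θ (exp c))) p n
      ≈⟨ +-cong (trans (*-congʳ (zeroˡ _)) (zeroˡ _)) (conv-cong (θ-exp c) (λ _ → refl) n) ⟩
    0# + conv (λ m → c * exp c m) p n
      ≈⟨ trans (+-identityˡ _) (conv-scaleˡ c (exp c) p n) ⟩
    c * conv (exp c) p n ∎

  -- Both sides have constant term 1 and satisfy θ p = (c + d) T p. This equation determines each
  -- coefficient from the preceding one because n + 1 is invertible.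
  exp-+ : ∀ c d → conv (exp c) (exp d) ≋ exp (c + d)
  exp-+ c d zero    = trans (*-cong (exp-at-0 c) (exp-at-0 d)) (trans (*-identityˡ 1#) (sym (exp-at-0 (c + d))))
  exp-+ c d (suc n) = φ-cancelˡ (F.charZero n) (begin
    φ (F.ι (suc n)) * conv (exp c) (exp d) (suc n)
      ≈⟨ *-congʳ (φ-natCast (suc n)) ⟩
    θ (conv (exp c) (exp d)) (suc n)
      ≈⟨ θ-conv (exp c) (exp d) (suc n) ⟩
    conv (θ (exp c)) (exp d) (suc n) + conv (exp c) (θ (exp d)) (suc n)
      ≈⟨ +-cong (θ-exp-conv c (exp d) n) (trans (conv-comm (exp c) (θ (exp d)) (suc n)) (θ-exp-conv d (exp c) n)) ⟩
    c * conv (exp c) (exp d) n + d * conv (exp d) (exp c) n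
      ≈⟨ +-congˡ (*-congˡ (conv-comm (exp d) (exp c) n)) ⟩
    c * conv (exp c) (exp d) n + d * conv (exp c) (exp d) n
      ≈⟨ distribʳ _ c d ⟨
    (c + d) * conv (exp c) (exp d) n
      ≈⟨ *-congˡ (exp-+ c d n) ⟩
    (c + d) * exp (c + d) n
      ≈⟨ θ-exp (c + d) n ⟨
    θ (exp (c + d)) (suc n)
      ≈⟨ *-congʳ (φ-natCast (suc n)) ⟨
    φ (F.ι (suc n)) * exp (c + d) (suc n) ∎)

  -- (e^{wT} − 1) / (wT)
  expDiv : Carrier → Series
  expDiv w = scale w (SF.tail invFact)

  tail-exp : ∀ w n → exp w (suc n) ≈ w * expDiv w n
  tail-exp w n = solve 3 (λ a b d → a :* (b :* d) := b :* (a :* d)) refl _ _ _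

  -- This is e^{uT} - 1 = (e^{wT} - 1) + e^{wT} (e^{vT} - 1) divided by T; u, v and w stay outside
  -- as factors because they need not be invertible.
  expDiv-+ : ∀ {u v w} → u ≈ w + v →
    ∀ n → u * expDiv u n ≈ w * expDiv w n + v * conv (expDiv v) (exp w) n
  expDiv-+ {u} {v} {w} u≈w+v n = begin
    u * expDiv u n                                       ≈⟨ tail-exp u n ⟨
    exp u (suc n)                                        ≈⟨ exp-cong (trans u≈w+v (+-comm w v)) (suc n) ⟩
    exp (v + w) (suc n)                                  ≈⟨ exp-+ v w (suc n) ⟨
    exp v 0 * exp w (suc n) + conv (tail (exp v)) (exp w) n
      ≈⟨ +-cong (trans (*-cong (exp-at-0 v) (tail-exp w n)) (*-identityˡ _))
           (trans (conv-cong (tail-exp v) (λ _ → refl) n) (conv-scaleˡ v (expDiv v) (exp w) n)) ⟩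
    w * expDiv w n + v * conv (expDiv v) (exp w) n       ∎

  -- The series being rescaled is e^{xT} over the field, unfolded to the form that `exp x` takes
  -- when φ is the identity.
  scale-exp : ∀ w x → scale w (λ n → invFact n F.* x ^F n) ≋ exp (φ x * w)
  scale-exp w x n = begin
    φ (invFact n F.* x ^F n) * w ^ n      ≈⟨ *-congʳ (φ.*-homo _ _) ⟩
    φ (invFact n) * φ (x ^F n) * w ^ n    ≈⟨ *-congʳ (*-congˡ (φ-^ x n)) ⟩
    φ (invFact n) * φ x ^ n * w ^ n       ≈⟨ *-assoc _ _ _ ⟩
    φ (invFact n) * (φ x ^ n * w ^ n)     ≈⟨ *-congˡ (^-distrib-* (φ x) w n) ⟨
    exp (φ x * w) n                       ∎

-- The two partial fraction identities

module CoreIdentities {c ℓ : Level} (R : CommutativeRing c ℓ) where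
  open CommutativeRing R
  open IntegerSolver R
  open import Relation.Binary.Reasoning.Setoid setoid

  inverse-unique : ∀ {p q r} → p * q ≈ 1# → r * q ≈ 1# → p ≈ r
  inverse-unique {p} {q} {r} pq≈1 rq≈1 = begin
    p             ≈⟨ *-identityʳ p ⟨
    p * 1#        ≈⟨ *-congˡ rq≈1 ⟨
    p * (r * q)   ≈⟨ solve 3 (λ p r q → p :* (r :* q) := p :* q :* r) refl p r q ⟩
    p * q * r     ≈⟨ *-congʳ pq≈1 ⟩
    1# * r        ≈⟨ *-identityˡ r ⟩
    r             ∎

  insert : ∀ {p q} → p * q ≈ 1# → ∀ a → a ≈ p * q * a
  insert pq≈1 a = sym (trans (*-congʳ pq≈1) (*-identityˡ a))

  -- Here γ is (e^{aT} - 1)/(aT) for a = u, v, w, β is its inverse, `ew` is e^{wT} and `e` the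
  -- common exponential factor. After inserting βw γw = 1, replacing w γw by u γu - v γv ew lets βu
  -- γu cancel in one term and βv γv in the other.
  bernoulli-core : ∀ {u v w βu βv βw γu γv γw ew} e →
    βu * γu ≈ 1# → βv * γv ≈ 1# → βw * γw ≈ 1# →
    u * γu ≈ w * γw + v * (γv * ew) →
    w * (βu * βv * e) ≈ u * (βw * βv * e) - v * (βw * βu * (ew * e))
  bernoulli-core {u} {v} {w} {βu} {βv} {βw} {γu} {γv} {γw} {ew} e βγu βγv βγw rel = begin
    w * (βu * βv * e)
      ≈⟨ insert βγw _ ⟩
    βw * γw * (w * (βu * βv * e))
      ≈⟨ solve 5 (λ w b g p r → b :* g :* (w :* p) := b :* p :* (w :* g :+ r) :- b :* p :* r) refl w βw γw (βu * βv * e) (v * (γv * ew)) ⟩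
    βw * (βu * βv * e) * (w * γw + v * (γv * ew)) - βw * (βu * βv * e) * (v * (γv * ew))
      ≈⟨ +-congʳ (*-congˡ rel) ⟨
    βw * (βu * βv * e) * (u * γu) - βw * (βu * βv * e) * (v * (γv * ew))
      ≈⟨ +-cong
           (solve 6 (λ u g a b d e → a :* (b :* d :* e) :* (u :* g) := b :* g :* (u :* (a :* d :* e))) refl u γu βw βu βv e)
           (-‿cong (solve 7 (λ v g f a b d e → a :* (b :* d :* e) :* (v :* (g :* f)) := d :* g :* (v :* (a :* b :* (f :* e)))) refl v γv ew βw βu βv e)) ⟩
    βu * γu * (u * (βw * βv * e)) - βv * γv * (v * (βw * βu * (ew * e)))
      ≈⟨ +-cong (insert βγu _) (-‿cong (insert βγv _)) ⟨
    u * (βw * βv * e) - v * (βw * βu * (ew * e)) ∎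

  -- Now κ is (e^{aT} + 1)/2, η its inverse and d is T/2; the relation between them expresses that
  -- e^{wT} (e^{vT} + 1)/2 - (e^{uT} + 1)/2 = (e^{wT} - 1)/2. Inserting βw γw = 1 and substituting
  -- makes ηv κv and ηu κu cancel.
  euler-core : ∀ {d w ηu ηv βw κu κv γw ew} e →
    ηu * κu ≈ 1# → ηv * κv ≈ 1# → βw * γw ≈ 1# →
    ew * κv - κu ≈ d * (w * γw) →
    d * (w * (ηu * ηv * e)) ≈ βw * ηu * (ew * e) - βw * ηv * e
  euler-core {d} {w} {ηu} {ηv} {βw} {κu} {κv} {γw} {ew} e ηκu ηκv βγw rel = begin
    d * (w * (ηu * ηv * e))
      ≈⟨ insert βγw _ ⟩
    βw * γw * (d * (w * (ηu * ηv * e)))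
      ≈⟨ solve 5 (λ d w b g p → b :* g :* (d :* (w :* p)) := b :* p :* (d :* (w :* g))) refl d w βw γw (ηu * ηv * e) ⟩
    βw * (ηu * ηv * e) * (d * (w * γw))
      ≈⟨ *-congˡ rel ⟨
    βw * (ηu * ηv * e) * (ew * κv - κu)
      ≈⟨ solve 7 (λ b p q e f k l → b :* (p :* q :* e) :* (f :* k :- l) := q :* k :* (b :* p :* (f :* e)) :- p :* l :* (b :* q :* e)) refl βw ηu ηv e ew κv κu ⟩
    ηv * κv * (βw * ηu * (ew * e)) - ηu * κu * (βw * ηv * e)
      ≈⟨ +-cong (insert ηκv _) (-‿cong (insert ηκu _)) ⟨
    βw * ηu * (ew * e) - βw * ηv * e ∎

module FieldSeries {c ℓ : Level} (F : CharZeroField c ℓ) where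
  open CharZeroField F
  open FieldDefs F using (½)
  open PowerSeries commutativeRing
  open Exponential F commutativeRing id (Identity.isRingHomomorphism rawRing refl) public

  -- (e^T + 1) / 2
  halfExpSucc : Series
  halfExpSucc n = ½ * (exp 1# n + const 1# n)

module ScaledIdentities {c ℓ c′ ℓ′ : Level} (F : CharZeroField c ℓ) (K : CommutativeRing c′ ℓ′)
  (φ : CharZeroField.Carrier F → CommutativeRing.Carrier K)
  (φ-homo : IsRingHomomorphism (CharZeroField.rawRing F) (CommutativeRing.rawRing K) φ)
  (β η : PowerSeries.Series (CharZeroField.commutativeRing F)) where

  private
    module F = CharZeroField F
    module SF where
      open PowerSeries F.commutativeRing public
      open FieldSeries F public using (exp; halfExpSucc)
    module φ = IsRingHomomorphism φ-homo
  open FieldDefs F using (½)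
  open CharZeroFieldProperties F using (invFact)
  open CommutativeRing K
  open IntegerSolver K
  open PowerSeries K
  open Exponential F K φ φ-homo
  open Exponentiation commutativeSemiring using (_^_)
  open import Relation.Binary.Reasoning.Setoid setoid
  private
    module S = CommutativeRing seriesRing
    module SSolver = IntegerSolver seriesRing

  -- p(wT) e^{xwT}
  withExp : SF.Series → Carrier → F.Carrier → Series
  withExp p w x = scale w (SF.conv p (SF.exp x))

  -- Gathers all dependence on x and y in a single exponential, the factor `e` of the core
  -- identities.
  withExp-conv : ∀ p q a b x y → conv (withExp p a x) (withExp q b y) ≋
    conv (conv (scale a p) (scale b q)) (exp (φ x * a + φ y * b))
  withExp-conv p q a b x y = S.trans (S.*-cong (split p a x) (split q b y))
    (S.trans (SSolver.solve 4 (λ p e q f → p :*′ e :*′ (q :*′ f) SSolver.:= p :*′ q :*′ (e :*′ f)) S.refl _ _ _ _)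
      (S.*-congˡ {scale a p S.* scale b q} (exp-+ (φ x * a) (φ y * b))))
    where
    infixl 7 _:*′_
    _:*′_ = SSolver._:*_
    split : ∀ p w x → withExp p w x ≋ conv (scale w p) (exp (φ x * w))
    split p w x = S.trans (scale-conv w p (SF.exp x)) (S.*-congˡ {scale w p} (scale-exp w x))

  scale-halfExpSucc : ∀ a → scale a SF.halfExpSucc ≋ conv (const (φ ½)) (exp a S.+ const 1#)
  scale-halfExpSucc a n = begin
    φ (½ F.* (SF.exp F.1# n F.+ SF.const F.1# n)) * a ^ n
      ≈⟨ *-congʳ (trans (φ.*-homo _ _) (*-congˡ (φ.+-homo _ _))) ⟩
    φ ½ * (φ (SF.exp F.1# n) + φ (SF.const F.1# n)) * a ^ n
      ≈⟨ solve 4 (λ h p q r → h :* (p :+ q) :* r := h :* (p :* r :+ q :* r)) refl _ _ _ _ ⟩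
    φ ½ * (scale a (SF.exp F.1#) n + scale a (SF.const F.1#) n)
      ≈⟨ *-congˡ (+-cong (trans (scale-exp a F.1# n) (exp-cong (trans (*-congʳ φ.1#-homo) (*-identityˡ a)) n))
           (scale-const-1 a n)) ⟩
    φ ½ * (exp a n + const 1# n)
      ≈⟨ const-conv (φ ½) _ n ⟨
    conv (const (φ ½)) (exp a S.+ const 1#) n ∎

  module _ {u v w : Carrier} (u≈w+v : u ≈ w + v) (β-inv : SF.conv β (SF.tail invFact) SF.≋ SF.const F.1#) where

    -- The reason for the arguments x and x + y: since u = w + v, the total exponent agrees with
    -- that of the left-hand side.
    exponent-wv : ∀ x y → φ x * w + φ (x F.+ y) * v ≈ φ x * u + φ y * v
    exponent-wv x y = begin
      φ x * w + φ (x F.+ y) * v      ≈⟨ +-congˡ (*-congʳ (φ.+-homo x y)) ⟩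
      φ x * w + (φ x + φ y) * v      ≈⟨ solve 4 (λ x y w v → x :* w :+ (x :+ y) :* v := x :* (w :+ v) :+ y :* v) refl _ _ _ _ ⟩
      φ x * (w + v) + φ y * v        ≈⟨ +-congʳ (*-congˡ u≈w+v) ⟨
      φ x * u + φ y * v              ∎

    -- The argument 1 - y instead of -y supplies the extra summand w, which is the factor e^{wT} in
    -- the core identities.
    exponent-wu : ∀ x y → φ (F.1# F.- y) * w + φ (x F.+ y) * u ≈ w + (φ x * u + φ y * v)
    exponent-wu x y = begin
      φ (F.1# F.- y) * w + φ (x F.+ y) * u
        ≈⟨ +-cong (*-congʳ (trans (φ.+-homo _ _) (+-cong φ.1#-homo (φ.-‿homo y)))) (*-cong (φ.+-homo x y) u≈w+v) ⟩
      (1# - φ y) * w + (φ x + φ y) * (w + v)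
        ≈⟨ solve 4 (λ x y w v → (:1 :- y) :* w :+ (x :+ y) :* (w :+ v) := w :+ (x :* (w :+ v) :+ y :* v)) refl _ _ _ _ ⟩
      w + (φ x * (w + v) + φ y * v)
        ≈⟨ +-congˡ (+-congʳ (*-congˡ u≈w+v)) ⟨
      w + (φ x * u + φ y * v) ∎

    expDiv-rel : conv (const u) (expDiv u) ≋ (conv (const w) (expDiv w) S.+ conv (const v) (conv (expDiv v) (exp w)))
    expDiv-rel n = trans (const-conv u _ n) (trans (expDiv-+ u≈w+v n)
      (sym (+-cong (const-conv w _ n) (const-conv v _ n))))

    bernoulli-identity : ∀ x y n →
      w * conv (withExp β u x) (withExp β v y) n ≈
      u * conv (withExp β w x) (withExp β v (x F.+ y)) n
        - v * conv (withExp β w (F.1# F.- y)) (withExp β u (x F.+ y)) n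
    bernoulli-identity x y n = begin
      w * conv (withExp β u x) (withExp β v y) n
        ≈⟨ *-congˡ (withExp-conv β β u v x y n) ⟩
      w * conv (conv (scale u β) (scale v β)) e n
        ≈⟨ const-conv w _ n ⟨
      conv (const w) (conv (conv (scale u β) (scale v β)) e) n
        ≈⟨ bernoulli-core e (inv u) (inv v) (inv w) expDiv-rel n ⟩
      conv (const u) (conv (conv (scale w β) (scale v β)) e) n
        - conv (const v) (conv (conv (scale w β) (scale u β)) (conv (exp w) e)) n
        ≈⟨ +-cong (const-conv u _ n) (-‿cong (const-conv v _ n)) ⟩
      u * conv (conv (scale w β) (scale v β)) e n
        - v * conv (conv (scale w β) (scale u β)) (conv (exp w) e) n
        ≈⟨ +-cong
             (*-congˡ (trans (withExp-conv β β w v x (x F.+ y) n)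
               (S.*-congˡ {conv (scale w β) (scale v β)} (exp-cong (exponent-wv x y)) n)))
             (-‿cong (*-congˡ (trans (withExp-conv β β w u (F.1# F.- y) (x F.+ y) n)
               (S.*-congˡ {conv (scale w β) (scale u β)} (S.trans (exp-cong (exponent-wu x y)) (S.sym (exp-+ w _))) n)))) ⟨
      u * conv (withExp β w x) (withExp β v (x F.+ y)) n
        - v * conv (withExp β w (F.1# F.- y)) (withExp β u (x F.+ y)) n ∎
      where
      open CoreIdentities seriesRing
      e : Series
      e = exp (φ x * u + φ y * v)
      inv : ∀ a → conv (scale a β) (expDiv a) ≋ const 1#
      inv a = scale-inverse a β _ β-inv

    module _ (η-inv : SF.conv η SF.halfExpSucc SF.≋ SF.const F.1#) where

      -- In this module `X` is the variable T of series over K, not the indeterminate later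
      -- substituted for u.
      exp-1 : (exp w S.- const 1#) ≋ conv X (conv (const w) (expDiv w))
      exp-1 zero    = trans (+-congʳ (exp-at-0 w)) (trans (-‿inverseʳ 1#) (sym (zeroˡ _)))
      exp-1 (suc n) = trans (solve 1 (λ a → a :- :0 := a) refl _) (trans (tail-exp w n)
        (sym (trans (X-conv _ n) (const-conv w _ n))))

      halfExpSucc-rel : (conv (exp w) (scale v SF.halfExpSucc) S.- scale u SF.halfExpSucc) ≋
        conv (conv (const (φ ½)) X) (conv (const w) (expDiv w))
      halfExpSucc-rel = S.trans
        (S.+-cong (S.*-congˡ {exp w} (scale-halfExpSucc v))
          (S.-‿cong (S.trans (scale-halfExpSucc u)
            (S.*-congˡ {const (φ ½)} (S.+-congʳ (S.trans (exp-cong u≈w+v) (S.sym (exp-+ w v))))))))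
        (S.trans (SSolver.solve 3 (λ h p q → SSolver._:-_ (p SSolver.:* (h SSolver.:* (q SSolver.:+ SSolver.:1)))
                                     (h SSolver.:* (p SSolver.:* q SSolver.:+ SSolver.:1))
                                   SSolver.:= h SSolver.:* (p SSolver.:- SSolver.:1)) S.refl (const (φ ½)) (exp w) (exp v))
          (S.trans (S.*-congˡ {const (φ ½)} exp-1)
            (S.sym (S.*-assoc (const (φ ½)) X (conv (const w) (expDiv w))))))

      -- The factor T of d = T/2 raises the degree, hence n on the left and `suc n` on the right.
      euler-identity : ∀ x y n →
        φ ½ * (w * conv (withExp η u x) (withExp η v y) n) ≈
        conv (withExp β w (F.1# F.- y)) (withExp η u (x F.+ y)) (suc n)
          - conv (withExp β w x) (withExp η v (x F.+ y)) (suc n)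
      euler-identity x y n = begin
        φ ½ * (w * conv (withExp η u x) (withExp η v y) n)
          ≈⟨ *-congˡ (*-congˡ (withExp-conv η η u v x y n)) ⟩
        φ ½ * (w * conv (conv (scale u η) (scale v η)) e n)
          ≈⟨ *-congˡ (const-conv w _ n) ⟨
        φ ½ * conv (const w) (conv (conv (scale u η) (scale v η)) e) n
          ≈⟨ *-congˡ (X-conv _ n) ⟨
        φ ½ * conv X (conv (const w) (conv (conv (scale u η) (scale v η)) e)) (suc n)
          ≈⟨ const-conv (φ ½) _ (suc n) ⟨
        conv (const (φ ½)) (conv X (conv (const w) (conv (conv (scale u η) (scale v η)) e))) (suc n)
          ≈⟨ S.*-assoc (const (φ ½)) X (conv (const w) (conv (conv (scale u η) (scale v η)) e)) (suc n) ⟨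
        conv (conv (const (φ ½)) X) (conv (const w) (conv (conv (scale u η) (scale v η)) e)) (suc n)
          ≈⟨ euler-core e (scale-inverse u η _ η-inv) (scale-inverse v η _ η-inv) (scale-inverse w β _ β-inv)
               halfExpSucc-rel (suc n) ⟩
        conv (conv (scale w β) (scale u η)) (conv (exp w) e) (suc n) - conv (conv (scale w β) (scale v η)) e (suc n)
          ≈⟨ +-cong
               (trans (withExp-conv β η w u (F.1# F.- y) (x F.+ y) (suc n))
                 (S.*-congˡ {conv (scale w β) (scale u η)} (S.trans (exp-cong (exponent-wu x y)) (S.sym (exp-+ w _))) (suc n)))
               (-‿cong (trans (withExp-conv β η w v x (x F.+ y) (suc n))
                 (S.*-congˡ {conv (scale w β) (scale v η)} (exp-cong (exponent-wv x y)) (suc n)))) ⟨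
        conv (withExp β w (F.1# F.- y)) (withExp η u (x F.+ y)) (suc n)
          - conv (withExp β w x) (withExp η v (x F.+ y)) (suc n) ∎
        where
        open CoreIdentities seriesRing
        e : Series
        e = exp (φ x * u + φ y * v)

-- Linear functionals and finite differences

module Functional {c ℓ : Level} (R : CommutativeRing c ℓ) where
  open CommutativeRing R
  open IntegerSolver R
  open PowerSeries R
  open import Relation.Binary.Reasoning.Setoid setoid
  private
    module P = CommutativeRing seriesRing
    module PSolver = IntegerSolver seriesRing
  open Exponentiation P.commutativeSemiring using (_^_)

  Δ : ℕ → (ℕ → Carrier) → ℕ → Carrier
  Δ zero    l a = l a
  Δ (suc k) l a = Δ k l (suc a) - Δ k l a

  -- The linear functional uⁱ ↦ l i on polynomials in u of degree below N.
  pairing : (ℕ → Carrier) → ℕ → Series → Carrier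
  pairing l zero    p = 0#
  pairing l (suc N) p = p 0 * l 0 + pairing (tail l) N (tail p)

  pairing-cong : ∀ l N {p q} → p ≋ q → pairing l N p ≈ pairing l N q
  pairing-cong l zero    p≋q = refl
  pairing-cong l (suc N) p≋q = +-cong (*-congʳ (p≋q 0)) (pairing-cong (tail l) N (λ n → p≋q (suc n)))

  pairing-+ : ∀ l N p q → pairing l N (p P.+ q) ≈ pairing l N p + pairing l N q
  pairing-+ l zero    p q = sym (+-identityˡ 0#)
  pairing-+ l (suc N) p q = trans (+-congˡ (pairing-+ (tail l) N (tail p) (tail q)))
    (solve 5 (λ a b c d e → (a :+ b) :* c :+ (d :+ e) := a :* c :+ d :+ (b :* c :+ e)) refl _ _ _ _ _)

  pairing-scale : ∀ l N a p → pairing l N (conv (const a) p) ≈ a * pairing l N p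
  pairing-scale l N a p = trans (pairing-cong l N (const-conv a p)) (go l N p)
    where
    go : ∀ l N p → pairing l N (λ n → a * p n) ≈ a * pairing l N p
    go l zero    p = sym (zeroʳ a)
    go l (suc N) p = trans (+-congˡ (go (tail l) N (tail p)))
      (solve 4 (λ a b c d → a :* b :* c :+ a :* d := a :* (b :* c :+ d)) refl _ _ _ _)

  pairing-neg : ∀ l N p → pairing l N (P.- p) ≈ - pairing l N p
  pairing-neg l zero    p = sym -0#≈0#
    where open RingProperties ring
  pairing-neg l (suc N) p = trans (+-congˡ (pairing-neg (tail l) N (tail p)))
    (solve 3 (λ a b c → (:- a) :* b :- c := :- (a :* b :+ c)) refl _ _ _)

  pairing-- : ∀ l N p q → pairing l N (p P.- q) ≈ pairing l N p - pairing l N q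
  pairing-- l N p q = trans (pairing-+ l N p (P.- q)) (+-congˡ (pairing-neg l N q))

  pairing-X : ∀ l N p → pairing l (suc N) (conv X p) ≈ pairing (tail l) N p
  pairing-X l N p = begin
    0# * p 0 * l 0 + pairing (tail l) N (tail (conv X p))
      ≈⟨ +-cong (trans (*-congʳ (zeroˡ _)) (zeroˡ _)) (pairing-cong (tail l) N (X-conv p)) ⟩
    0# + pairing (tail l) N p   ≈⟨ +-identityˡ _ ⟩
    pairing (tail l) N p        ∎

  pairing-X^ : ∀ l N a → a < N → pairing l N (X ^ a) ≈ l a
  pairing-X^ l (suc N) zero    _         = begin
    1# * l 0 + pairing (tail l) N (λ _ → 0#)   ≈⟨ +-cong (*-identityˡ _) (pairing-0 (tail l) N) ⟩
    l 0 + 0#                                   ≈⟨ +-identityʳ _ ⟩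
    l 0                                        ∎
    where
    pairing-0 : ∀ l N → pairing l N (λ _ → 0#) ≈ 0#
    pairing-0 l zero    = refl
    pairing-0 l (suc N) = trans (+-cong (zeroˡ _) (pairing-0 (tail l) N)) (+-identityˡ 0#)
  pairing-X^ l (suc N) (suc a) (s≤s a<N) = trans (pairing-X l N (X ^ a)) (pairing-X^ (tail l) N a a<N)

  X-1 : Series
  X-1 = X P.- P.1#

  -- Multiplication by X shifts l, so each factor X - 1 contributes one forward difference. The
  -- bound ensures that the truncated functional sees the whole polynomial.
  pairing-moment : ∀ l N k a → k ℕ.+ a < N → pairing l N ((X-1 ^ k) P.* (X ^ a)) ≈ Δ k l a
  pairing-moment l N zero    a a<N = trans (pairing-cong l N (P.*-identityˡ (X ^ a))) (pairing-X^ l N a a<N)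
  pairing-moment l N (suc k) a k+a<N = begin
    pairing l N ((X-1 P.* (X-1 ^ k)) P.* (X ^ a))
      ≈⟨ pairing-cong l N (PSolver.solve 3 (λ x p q → (x PSolver.:- PSolver.:1) PSolver.:* p PSolver.:* q
           PSolver.:= p PSolver.:* (x PSolver.:* q) PSolver.:- p PSolver.:* q) P.refl X (X-1 ^ k) (X ^ a)) ⟩
    pairing l N (((X-1 ^ k) P.* (X ^ suc a)) P.- ((X-1 ^ k) P.* (X ^ a)))
      ≈⟨ pairing-- l N ((X-1 ^ k) P.* (X ^ suc a)) ((X-1 ^ k) P.* (X ^ a)) ⟩
    pairing l N ((X-1 ^ k) P.* (X ^ suc a)) - pairing l N ((X-1 ^ k) P.* (X ^ a))
      ≈⟨ +-cong (pairing-moment l N k (suc a) (≡.subst (_< N) (≡.sym (ℕ.+-suc k a)) k+a<N))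
           (-‿cong (pairing-moment l N k a (ℕ.<-trans (ℕ.n<1+n _) k+a<N))) ⟩
    Δ k l (suc a) - Δ k l a ∎

-- Here u = X, v = 1 and w = X − 1.
module FunctionalIdentities {c ℓ : Level} (F : CharZeroField c ℓ)
  (β η : PowerSeries.Series (CharZeroField.commutativeRing F)) where
  open CharZeroField F
  open FieldDefs F using (½)
  open PowerSeries commutativeRing
  open CharZeroFieldProperties F using (invFact)
  open FieldSeries F
  open Functional commutativeRing
  private
    module P = CommutativeRing seriesRing
    module PSolver = IntegerSolver seriesRing
    module PP = PowerSeries seriesRing
    module PE = Exponential F seriesRing const const-isRingHomomorphism
  open Exponentiation P.commutativeSemiring using (_^_)
  open ScaledIdentities F seriesRing const const-isRingHomomorphism β η
    using (withExp; bernoulli-identity; euler-identity)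
  open import Relation.Binary.Reasoning.Setoid setoid

  pairing-anti : ∀ l N n f → pairing l N (PP.anti n f) ≈ anti n (λ k m → pairing l N (f k m))
  pairing-anti l N zero    f = refl
  pairing-anti l N (suc n) f = trans (pairing-+ l N (f 0 (suc n)) _) (+-congˡ (pairing-anti l N n _))

  -- The coefficient of Tⁿ in p(aT) q(bT) is a sum of aᵏ bᵐ with coefficients in the field, which
  -- the functional respects. The prefactor s will be one of X - 1, X and 1.
  pairing-conv : ∀ l N s a b p q n →
    pairing l N (s P.* PP.conv (PE.scale a p) (PE.scale b q) n) ≈
    anti n (λ k m → p k * q m * pairing l N (s P.* ((a ^ k) P.* (b ^ m))))
  pairing-conv l N s a b p q n = begin
    pairing l N (s P.* PP.conv (PE.scale a p) (PE.scale b q) n)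
      ≈⟨ pairing-cong l N (PP.anti-* n s _) ⟨
    pairing l N (PP.anti n (λ k m → s P.* (PE.scale a p k P.* PE.scale b q m)))
      ≈⟨ pairing-anti l N n _ ⟩
    anti n (λ k m → pairing l N (s P.* (PE.scale a p k P.* PE.scale b q m)))
      ≈⟨ anti-cong n (λ k m _ → trans (pairing-cong l N (shuffle k m)) (pairing-scale l N (p k * q m) _)) ⟩
    anti n (λ k m → p k * q m * pairing l N (s P.* ((a ^ k) P.* (b ^ m)))) ∎
    where
    shuffle : ∀ k m → (s P.* (PE.scale a p k P.* PE.scale b q m)) ≋
      (const (p k * q m) P.* (s P.* ((a ^ k) P.* (b ^ m))))
    shuffle k m = P.trans
      (PSolver.solve 5 (λ s x a y b → s PSolver.:* (x PSolver.:* a PSolver.:* (y PSolver.:* b))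
        PSolver.:= x PSolver.:* y PSolver.:* (s PSolver.:* (a PSolver.:* b))) P.refl s (const (p k)) (a ^ k) (const (q m)) (b ^ m))
      (P.*-congʳ (P.sym (IsRingHomomorphism.*-homo const-isRingHomomorphism (p k) (q m))))

  1^ : ∀ m → (P.1# ^ m) ≋ P.1#
  1^ zero    = P.refl
  1^ (suc m) = P.trans (P.*-identityˡ (P.1# ^ m)) (1^ m)

  -- The prefactor w on the left-hand side is what turns l into its first difference.
  moment-difference : ∀ l {n} k m → k ℕ.+ m ≡ n →
    pairing l (suc (suc n)) (X-1 P.* ((X ^ k) P.* (P.1# ^ m))) ≈ l (suc k) - l k
  moment-difference l {n} k m ≡.refl = trans
    (pairing-cong l (suc (suc n)) (P.*-cong (P.sym (P.*-identityʳ X-1))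
      (P.trans (P.*-congˡ {X ^ k} (1^ m)) (P.*-identityʳ (X ^ k)))))
    (pairing-moment l (suc (suc n)) 1 k (s≤s (s≤s (ℕ.m≤m+n k m))))

  -- The prefactor u = X moves the base point of the difference from 0 to 1; this is why the
  -- Bernoulli and Euler cases later need different additive constants.
  moment-at-1 : ∀ l {n} k m → k ℕ.+ m ≡ n →
    pairing l (suc (suc n)) (X P.* ((X-1 ^ k) P.* (P.1# ^ m))) ≈ Δ k l 1
  moment-at-1 l {n} k m ≡.refl = trans
    (pairing-cong l (suc (suc n)) (P.trans (P.*-congˡ {X} (P.*-congˡ {X-1 ^ k} (1^ m)))
      (PSolver.solve 2 (λ x p → x PSolver.:* (p PSolver.:* PSolver.:1) PSolver.:= p PSolver.:* (x PSolver.:* PSolver.:1)) P.refl X (X-1 ^ k))))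
    (pairing-moment l (suc (suc n)) k 1 (≡.subst (_< suc (suc n)) (ℕ.+-comm 1 k) (s≤s (s≤s (ℕ.m≤m+n k m)))))

  -- When the second series is scaled by u, the power Xᵐ makes the base point of the difference vary
  -- with m.
  moment-mixed : ∀ l {N n} k m → k ℕ.+ m ≡ n → n < N →
    pairing l N (P.1# P.* ((X-1 ^ k) P.* (X ^ m))) ≈ Δ k l m
  moment-mixed l {N} {n} k m ≡.refl n<N = trans
    (pairing-cong l N (P.*-identityˡ ((X-1 ^ k) P.* (X ^ m)))) (pairing-moment l N k m n<N)

  moment-at-0 : ∀ l {N n} k m → k ℕ.+ m ≡ n → n < N →
    pairing l N (P.1# P.* ((X-1 ^ k) P.* (P.1# ^ m))) ≈ Δ k l 0
  moment-at-0 l {N} {n} k m ≡.refl n<N = trans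
    (pairing-cong l N (P.trans (P.*-identityˡ ((X-1 ^ k) P.* (P.1# ^ m))) (P.*-congˡ {X-1 ^ k} (1^ m))))
    (pairing-moment l N k 0 (≡.subst (_< N) (≡.sym (ℕ.+-identityʳ k)) (ℕ.≤-<-trans (ℕ.m≤m+n k m) n<N)))

  X≈X-1+1 : X ≋ (X-1 P.+ P.1#)
  X≈X-1+1 = PSolver.solve 1 (λ x → x PSolver.:= x PSolver.:- PSolver.:1 PSolver.:+ PSolver.:1) P.refl X

  module _ (β-inv : conv β (tail invFact) ≋ const 1#) where

    bernoulli-functional : ∀ l x y n →
      anti n (λ k m → conv β (exp x) k * conv β (exp y) m * (l (suc k) - l k)) ≈
      anti n (λ k m → conv β (exp x) k * conv β (exp (x + y)) m * Δ k l 1)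
        - anti n (λ k m → conv β (exp (1# - y)) k * conv β (exp (x + y)) m * Δ k l m)
    bernoulli-functional l x y n = begin
      anti n (λ k m → conv β (exp x) k * conv β (exp y) m * (l (suc k) - l k))
        ≈⟨ anti-cong n (λ k m e → *-congˡ (moment-difference l k m e)) ⟨
      anti n (λ k m → conv β (exp x) k * conv β (exp y) m * L (X-1 P.* ((X ^ k) P.* (P.1# ^ m))))
        ≈⟨ pairing-conv l N X-1 X P.1# _ _ n ⟨
      L (X-1 P.* PP.conv (withExp β X x) (withExp β P.1# y) n)
        ≈⟨ pairing-cong l N (bernoulli-identity X≈X-1+1 β-inv x y n) ⟩
      L ((X P.* PP.conv (withExp β X-1 x) (withExp β P.1# (x + y)) n)
        P.- (P.1# P.* PP.conv (withExp β X-1 (1# - y)) (withExp β X (x + y)) n))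
        ≈⟨ pairing-- l N (X P.* PP.conv (withExp β X-1 x) (withExp β P.1# (x + y)) n)
             (P.1# P.* PP.conv (withExp β X-1 (1# - y)) (withExp β X (x + y)) n) ⟩
      L (X P.* PP.conv (withExp β X-1 x) (withExp β P.1# (x + y)) n)
        - L (P.1# P.* PP.conv (withExp β X-1 (1# - y)) (withExp β X (x + y)) n)
        ≈⟨ +-cong
             (trans (pairing-conv l N X X-1 P.1# (conv β (exp x)) (conv β (exp (x + y))) n) (anti-cong n (λ k m e → *-congˡ (moment-at-1 l k m e))))
             (-‿cong (trans (pairing-conv l N P.1# X-1 X (conv β (exp (1# - y))) (conv β (exp (x + y))) n)
               (anti-cong n (λ k m e → *-congˡ (moment-mixed l k m e (ℕ.<-trans (ℕ.n<1+n n) (ℕ.n<1+n _))))))) ⟩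
      anti n (λ k m → conv β (exp x) k * conv β (exp (x + y)) m * Δ k l 1)
        - anti n (λ k m → conv β (exp (1# - y)) k * conv β (exp (x + y)) m * Δ k l m) ∎
      where
      N : ℕ
      -- The prefactors X - 1 and X raise the degree in X to at most n + 1.
      N = suc (suc n)
      L : Series → Carrier
      L = pairing l N

    euler-functional : conv η halfExpSucc ≋ const 1# → ∀ l x y n →
      ½ * anti n (λ k m → conv η (exp x) k * conv η (exp y) m * (l (suc k) - l k)) ≈
      anti (suc n) (λ k m → conv β (exp (1# - y)) k * conv η (exp (x + y)) m * Δ k l m)
        - anti (suc n) (λ k m → conv β (exp x) k * conv η (exp (x + y)) m * Δ k l 0)
    euler-functional η-inv l x y n = begin
      ½ * anti n (λ k m → conv η (exp x) k * conv η (exp y) m * (l (suc k) - l k))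
        ≈⟨ *-congˡ (anti-cong n (λ k m e → *-congˡ (moment-difference l k m e))) ⟨
      ½ * anti n (λ k m → conv η (exp x) k * conv η (exp y) m * L (X-1 P.* ((X ^ k) P.* (P.1# ^ m))))
        ≈⟨ *-congˡ (pairing-conv l N X-1 X P.1# _ _ n) ⟨
      ½ * L (X-1 P.* PP.conv (withExp η X x) (withExp η P.1# y) n)
        ≈⟨ pairing-scale l N ½ _ ⟨
      L (const ½ P.* (X-1 P.* PP.conv (withExp η X x) (withExp η P.1# y) n))
        ≈⟨ pairing-cong l N (euler-identity X≈X-1+1 β-inv η-inv x y n) ⟩
      L (A P.- B)
        ≈⟨ pairing-- l N A B ⟩
      L A - L B
        -- A trivial prefactor 1 is inserted so that `pairing-conv` applies.
        ≈⟨ +-cong (pairing-cong l N (P.*-identityˡ A)) (-‿cong (pairing-cong l N (P.*-identityˡ B))) ⟨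
      L (P.1# P.* A) - L (P.1# P.* B)
        ≈⟨ +-cong
             (trans (pairing-conv l N P.1# X-1 X (conv β (exp (1# - y))) (conv η (exp (x + y))) (suc n))
               (anti-cong (suc n) (λ k m e → *-congˡ {conv β (exp (1# - y)) k * conv η (exp (x + y)) m} (moment-mixed l k m e (ℕ.n<1+n (suc n))))))
             (-‿cong (trans (pairing-conv l N P.1# X-1 P.1# (conv β (exp x)) (conv η (exp (x + y))) (suc n))
               (anti-cong (suc n) (λ k m e → *-congˡ {conv β (exp x) k * conv η (exp (x + y)) m} (moment-at-0 l k m e (ℕ.n<1+n (suc n))))))) ⟩
      anti (suc n) (λ k m → conv β (exp (1# - y)) k * conv η (exp (x + y)) m * Δ k l m)
        - anti (suc n) (λ k m → conv β (exp x) k * conv η (exp (x + y)) m * Δ k l 0) ∎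
      where
      N : ℕ
      N = suc (suc n)
      L : Series → Carrier
      L = pairing l N
      A B : Series
      A = PP.conv (withExp β X-1 (1# - y)) (withExp η X (x + y)) (suc n)
      B = PP.conv (withExp β X-1 x) (withExp η P.1# (x + y)) (suc n)

-- Bounded sums, binomial coefficients and reciprocals

binomial-factorial : ∀ k m → ((k ℕ.+ m) C k) ℕ.* (k ! ℕ.* m !) ≡ (k ℕ.+ m) !
binomial-factorial k m = begin
  ((k ℕ.+ m) C k) ℕ.* (k ! ℕ.* m !)
    ≡⟨ ≡.cong (λ j → ((k ℕ.+ m) C k) ℕ.* (k ! ℕ.* j !)) (ℕ.m+n∸m≡n k m) ⟨
  ((k ℕ.+ m) C k) ℕ.* d
    ≡⟨ ≡.cong (ℕ._* d) (nCk≡n!/k![n-k]! (ℕ.m≤m+n k m)) ⟩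
  ((k ℕ.+ m) ! ℕ./ d) ℕ.* d
    ≡⟨ ℕ.m/n*n≡m (k![n∸k]!∣n! (ℕ.m≤m+n k m)) ⟩
  (k ℕ.+ m) ! ∎
  where
  open ≡.≡-Reasoning
  d : ℕ
  d = k ! ℕ.* (k ℕ.+ m ∸ k) !
  instance
    _ : ℕ.NonZero d
    _ = k ℕ.!* (k ℕ.+ m ∸ k) !≢0

module FieldSums {c ℓ : Level} (F : CharZeroField c ℓ) where
  open CharZeroField F
  open FieldDefs F
  open IntegerSolver commutativeRing
  open PowerSeries commutativeRing
  open CharZeroFieldProperties F
  open Exponentiation commutativeSemiring using (_^_)
  open import Relation.Binary.Reasoning.Setoid setoid

  -- The bridge from sums over k with second index n ∸ k to antidiagonal sums; the offset a also
  -- covers sums that start at 1.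
  sumCount-anti : ∀ a n {g : ℕ → Carrier} {f : ℕ → ℕ → Carrier} →
    (∀ k m → k ℕ.+ m ≡ n → g (a ℕ.+ k) ≈ f k m) → sumCount a (suc n) g ≈ anti n f
  sumCount-anti a zero {g} g≈f = trans (+-identityʳ _)
    (trans (reflexive (≡.cong g (≡.sym (ℕ.+-identityʳ a)))) (g≈f 0 0 ≡.refl))
  sumCount-anti a (suc n) {g} g≈f = +-cong
    (trans (reflexive (≡.cong g (≡.sym (ℕ.+-identityʳ a)))) (g≈f 0 (suc n) ≡.refl))
    (sumCount-anti (suc a) n (λ k m e →
      trans (reflexive (≡.cong g (≡.sym (ℕ.+-suc a k)))) (g≈f (suc k) m (≡.cong suc e))))

  choose-invFact : ∀ {n} k m → k ℕ.+ m ≡ n → choose n k ≈ ι (n !) * (invFact k * invFact m)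
  choose-invFact k m ≡.refl = begin
    ch                                                    ≈⟨ *-identityʳ _ ⟨
    ch * 1#                                                ≈⟨ *-congˡ (*-identityʳ _) ⟨
    ch * (1# * 1#)                                         ≈⟨ *-congˡ (*-cong (!-invFact k) (!-invFact m)) ⟨
    ch * (ι (k !) * invFact k * (ι (m !) * invFact m))
      ≈⟨ solve 5 (λ a b d e f → a :* (b :* d :* (e :* f)) := a :* (b :* e) :* (d :* f)) refl ch _ _ _ _ ⟩
    ch * (ι (k !) * ι (m !)) * (invFact k * invFact m)
      ≈⟨ *-congʳ (trans (ι-* ((k ℕ.+ m) C k) (k ! ℕ.* m !)) (*-congˡ (ι-* (k !) (m !)))) ⟨
    ι (((k ℕ.+ m) C k) ℕ.* (k ! ℕ.* m !)) * (invFact k * invFact m)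
      ≈⟨ *-congʳ (reflexive (≡.cong ι (binomial-factorial k m))) ⟩
    ι ((k ℕ.+ m) !) * (invFact k * invFact m) ∎
    where
    ch : Carrier
    ch = choose (k ℕ.+ m) k

  pow≡^ : ∀ x n → pow x n ≡ x ^ n
  pow≡^ x zero    = ≡.refl
  pow≡^ x (suc n) = ≡.cong (x *_) (pow≡^ x n)

  1≉0 : ¬ (1# ≈ 0#)
  1≉0 1≈0 = charZero 0 (trans (+-identityʳ 1#) 1≈0)

  -- Having an inverse already excludes x ≈ 0, so x may be cancelled. This serves where one would
  -- otherwise rewrite under `_⁻¹`.
  ⁻¹-unique : ∀ {x y} → x * y ≈ 1# → x ⁻¹ ≈ y
  ⁻¹-unique {x} {y} xy≈1 = *-cancelˡ x≉0 (trans (⁻¹-inverse x x≉0) (sym xy≈1))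
    where
    x≉0 : ¬ (x ≈ 0#)
    x≉0 x≈0 = 1≉0 (trans (sym xy≈1) (trans (*-congʳ x≈0) (zeroˡ y)))

  ι2 : ι 2 ≈ 1# + 1#
  ι2 = +-congˡ (+-identityʳ 1#)

  2*½ : ι 2 * ½ ≈ 1#
  2*½ = ⁻¹-inverse _ (charZero 1)

  ½+½ : ½ + ½ ≈ 1#
  ½+½ = trans (trans (solve 1 (λ h → h :+ h := (:1 :+ :1) :* h) refl ½) (*-congʳ (sym ι2))) 2*½

  pow-2-inverse : ∀ k → pow (ι 2) k ⁻¹ ≈ ½ ^ k
  pow-2-inverse k = ⁻¹-unique (go k)
    where
    go : ∀ k → pow (ι 2) k * ½ ^ k ≈ 1#
    go zero    = *-identityˡ 1#
    go (suc k) = begin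
      ι 2 * pow (ι 2) k * (½ * ½ ^ k)     ≈⟨ solve 4 (λ a b d e → a :* b :* (d :* e) := a :* d :* (b :* e)) refl (ι 2) _ _ _ ⟩
      ι 2 * ½ * (pow (ι 2) k * ½ ^ k)     ≈⟨ *-cong 2*½ (go k) ⟩
      1# * 1#                             ≈⟨ *-identityˡ 1# ⟩
      1#                                  ∎

-- Generating functions of the Bernoulli and Euler polynomials

module BernoulliSeries {c ℓ : Level} (F : CharZeroField c ℓ) where
  open CharZeroField F
  open FieldDefs F
  open IntegerSolver commutativeRing
  open PowerSeries commutativeRing
  open CharZeroFieldProperties F
  open FieldSums F
  open FieldSeries F
  open Exponentiation commutativeSemiring using (_^_)
  open import Relation.Binary.Reasoning.Setoid setoid

  bernTab-stable : ∀ n k → k ≤ n → bernTab n k ≡ bernoulli k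
  bernTab-stable zero    zero z≤n = ≡.refl
  bernTab-stable (suc n) k k≤1+n with ℕ.m≤n⇒m<n∨m≡n k≤1+n
  ... | inj₂ ≡.refl = ≡.refl
  ... | inj₁ (s≤s k≤n) with k ≤? n
  ...   | yes _   = bernTab-stable n k k≤n
  ...   | no k≰n  = contradiction k≤n k≰n

  bernoulli-suc : ∀ n → bernoulli (suc n) ≡
    - ((ι (suc (suc n))) ⁻¹ * (∑[ j ∈ 0 ⋯ n ] (choose (suc (suc n)) j * bernTab n j)))
  bernoulli-suc n with suc n ≤? n
  ... | yes 1+n≤n = contradiction 1+n≤n ℕ.1+n≰n
  ... | no _      = ≡.refl

  choose-pred : ∀ n → choose (suc n) n ≡ ι (suc n)
  choose-pred n = ≡.cong ι (≡.trans (nCk≡nC[n∸k] (ℕ.n≤1+n n))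
    (≡.trans (≡.cong (suc n C_) (ℕ.m+n∸n≡m 1 n)) (nC1≡n (suc n))))

  -- The last term carries the binomial coefficient C(n+2, n+1) = n + 2, which cancels the
  -- reciprocal in the definition of the new Bernoulli number.
  bernoulli-recurrence : ∀ n → anti (suc n) (λ k m → choose (suc (suc n)) k * bernoulli k) ≈ 0#
  bernoulli-recurrence n = begin
    anti (suc n) (λ k m → choose N k * bernoulli k)
      ≈⟨ anti-last n (λ k m → choose N k * bernoulli k) ⟩
    choose N (suc n) * bernoulli (suc n) + S
      ≈⟨ +-congʳ (*-cong (reflexive (choose-pred (suc n))) (reflexive (bernoulli-suc n))) ⟩
    ι N * - (ι N ⁻¹ * (∑[ j ∈ 0 ⋯ n ] (choose N j * bernTab n j))) + S
      ≈⟨ +-congʳ (*-congˡ (-‿cong (*-congˡ (sumCount-anti 0 n tab)))) ⟩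
    ι N * - (ι N ⁻¹ * S) + S
      ≈⟨ solve 3 (λ a b s → a :* :- (b :* s) :+ s := s :- a :* b :* s) refl (ι N) _ S ⟩
    S - ι N * ι N ⁻¹ * S
      ≈⟨ +-congˡ (-‿cong (trans (*-congʳ (⁻¹-inverse _ (charZero (suc n)))) (*-identityˡ S))) ⟩
    S - S
      ≈⟨ -‿inverseʳ S ⟩
    0# ∎
    where
    N : ℕ
    N = suc (suc n)
    S : Carrier
    S = anti n (λ k m → choose N k * bernoulli k)
    tab : ∀ k m → k ℕ.+ m ≡ n → choose N k * bernTab n k ≈ choose N k * bernoulli k
    tab k m ≡.refl = *-congˡ (reflexive (bernTab-stable n k (ℕ.m≤m+n k m)))

  β : Series
  β n = bernoulli n * invFact n

  -- The recurrence read as a product of series: (n+2)! times the coefficient of T^{n+1} in β (e^T -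
  -- 1)/T is Σ C(n+2, k) B_k.
  β-inv : conv β (tail invFact) ≋ const 1#
  β-inv zero    = begin
    1# * invFact 0 * invFact 0   ≈⟨ *-cong (trans (*-identityˡ _) invFact-0) invFact-0 ⟩
    1# * 1#                      ≈⟨ *-identityˡ 1# ⟩
    1#                           ∎
  β-inv (suc n) = *-cancelˡ (ι-! (suc (suc n))) (begin
    ι (suc (suc n) !) * conv β (tail invFact) (suc n)
      ≈⟨ anti-* (suc n) (ι (suc (suc n) !)) (λ k m → β k * invFact (suc m)) ⟨
    anti (suc n) (λ k m → ι (suc (suc n) !) * (bernoulli k * invFact k * invFact (suc m)))
      ≈⟨ anti-cong (suc n) (λ k m e → trans
           (solve 4 (λ a b d e → a :* (b :* d :* e) := a :* (d :* e) :* b) refl (ι (suc (suc n) !)) (bernoulli k) (invFact k) (invFact (suc m)))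
           (*-congʳ (sym (choose-invFact k (suc m) (≡.trans (ℕ.+-suc k m) (≡.cong suc e)))))) ⟩
    anti (suc n) (λ k m → choose (suc (suc n)) k * bernoulli k)
      ≈⟨ bernoulli-recurrence n ⟩
    0#
      ≈⟨ zeroʳ _ ⟨
    ι (suc (suc n) !) * 0# ∎)

  -- B_n(x) = n! b_n(x)
  b : Carrier → Series
  b x = conv β (exp x)

  bernoulliPoly-b : ∀ n x → bernoulliPoly n x ≈ ι (n !) * b x n
  bernoulliPoly-b n x = trans (sumCount-anti 0 n term) (anti-* n _ _)
    where
    term : ∀ k m → k ℕ.+ m ≡ n → choose n k * bernoulli k * pow x (n ∸ k) ≈ ι (n !) * (β k * exp x m)
    term k m ≡.refl = begin
      choose n k * bernoulli k * pow x (n ∸ k)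
        ≡⟨ ≡.cong (choose n k * bernoulli k *_) (≡.trans (≡.cong (pow x) (ℕ.m+n∸m≡n k m)) (pow≡^ x m)) ⟩
      choose n k * bernoulli k * x ^ m
        ≈⟨ *-congʳ (*-congʳ (choose-invFact k m ≡.refl)) ⟩
      ι (n !) * (invFact k * invFact m) * bernoulli k * x ^ m
        ≈⟨ solve 5 (λ a i j b p → a :* (i :* j) :* b :* p := a :* (b :* i :* (j :* p))) refl (ι (n !)) _ _ _ _ ⟩
      ι (n !) * (β k * exp x m) ∎

module EulerSeries {c ℓ : Level} (F : CharZeroField c ℓ) where
  open CharZeroField F
  open FieldDefs F
  open IntegerSolver commutativeRing
  open PowerSeries commutativeRing
  open CharZeroFieldProperties F
  open FieldSums F
  open FieldSeries F
  open Exponentiation commutativeSemiring using (_^_; ^-homo-*)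
  open import Relation.Binary.Reasoning.Setoid setoid
  private
    module S = CommutativeRing seriesRing
    module SSolver = IntegerSolver seriesRing

  eulTab-stable : ∀ n k → k ≤ n → eulTab n k ≡ euler k
  eulTab-stable zero    zero z≤n = ≡.refl
  eulTab-stable (suc n) k k≤1+n with ℕ.m≤n⇒m<n∨m≡n k≤1+n
  ... | inj₂ ≡.refl = ≡.refl
  ... | inj₁ (s≤s k≤n) with k ≤? n
  ...   | yes _   = eulTab-stable n k k≤n
  ...   | no k≰n  = contradiction k≤n k≰n

  euler-suc : ∀ n → euler (suc n) ≡
    - (∑[ j ∈ 0 ⋯ n ] (if isEven (suc n ∸ j) then choose (suc n) j * eulTab n j else 0#))
  euler-suc n with suc n ≤? n
  ... | yes 1+n≤n = contradiction 1+n≤n ℕ.1+n≰n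
  ... | no _      = ≡.refl

  -- As a factor instead of a condition, evenness turns the Euler recurrence into a convolution with
  -- a hyperbolic cosine.
  parity : ℕ → Carrier
  parity m = if isEven m then 1# else 0#

  if-parity : ∀ m a → (if isEven m then a else 0#) ≈ parity m * a
  if-parity m a with isEven m
  ... | true  = sym (*-identityˡ a)
  ... | false = sym (zeroˡ a)

  euler-recurrence : ∀ n → anti (suc n) (λ k m → parity m * (choose (suc n) k * euler k)) ≈ 0#
  euler-recurrence n = begin
    anti (suc n) (λ k m → parity m * (choose (suc n) k * euler k))
      ≈⟨ anti-last n (λ k m → parity m * (choose (suc n) k * euler k)) ⟩
    1# * (choose (suc n) (suc n) * euler (suc n)) + S
      ≈⟨ +-congʳ (*-congˡ (*-cong
           (trans (reflexive (≡.cong ι (nCn≡1 (suc n)))) (+-identityʳ 1#))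
           (trans (reflexive (euler-suc n)) (-‿cong (sumCount-anti 0 n tab))))) ⟩
    1# * (1# * - S) + S
      ≈⟨ solve 1 (λ s → :1 :* (:1 :* :- s) :+ s := :0) refl S ⟩
    0# ∎
    where
    S : Carrier
    S = anti n (λ k m → parity (suc m) * (choose (suc n) k * euler k))
    tab : ∀ k m → k ℕ.+ m ≡ n → (if isEven (suc n ∸ k) then choose (suc n) k * eulTab n k else 0#) ≈
      parity (suc m) * (choose (suc n) k * euler k)
    tab k m ≡.refl = begin
      (if isEven (suc n ∸ k) then choose (suc n) k * eulTab n k else 0#)
        ≈⟨ if-parity (suc n ∸ k) _ ⟩
      parity (suc n ∸ k) * (choose (suc n) k * eulTab n k)
        ≡⟨ ≡.cong₂ (λ i e → parity i * (choose (suc n) k * e))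
             (≡.trans (≡.cong (_∸ k) (≡.sym (ℕ.+-suc k m))) (ℕ.m+n∸m≡n k (suc m)))
             (eulTab-stable n k (ℕ.m≤m+n k m)) ⟩
      parity (suc m) * (choose (suc n) k * euler k) ∎

  -- `ε` is sech(T/2), the halves coming from the denominators 2^k of the Euler polynomials.
  -- `sech⁻¹` is its multiplicative inverse cosh(T/2), not the inverse function.
  ε sech⁻¹ : Series
  ε n = euler n * ½ ^ n * invFact n
  sech⁻¹ n = parity n * ½ ^ n * invFact n

  ε-inv : conv ε sech⁻¹ ≋ const 1#
  ε-inv zero    = begin
    1# * 1# * invFact 0 * (1# * 1# * invFact 0)
      ≈⟨ *-cong (*-congˡ invFact-0) (*-congˡ invFact-0) ⟩
    1# * 1# * 1# * (1# * 1# * 1#)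
      ≈⟨ solve 0 (:1 :* :1 :* :1 :* (:1 :* :1 :* :1) := :1) refl ⟩
    1# ∎
  ε-inv (suc n) = *-cancelˡ (ι-! (suc n)) (begin
    ι (suc n !) * conv ε sech⁻¹ (suc n)
      ≈⟨ anti-* (suc n) (ι (suc n !)) (λ k m → ε k * sech⁻¹ m) ⟨
    anti (suc n) (λ k m → ι (suc n !) * (ε k * sech⁻¹ m))
      ≈⟨ anti-cong (suc n) term ⟩
    anti (suc n) (λ k m → ½ ^ suc n * (parity m * (choose (suc n) k * euler k)))
      ≈⟨ anti-* (suc n) (½ ^ suc n) (λ k m → parity m * (choose (suc n) k * euler k)) ⟩
    ½ ^ suc n * anti (suc n) (λ k m → parity m * (choose (suc n) k * euler k))
      ≈⟨ *-congˡ (euler-recurrence n) ⟩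
    ½ ^ suc n * 0#
      ≈⟨ trans (zeroʳ _) (sym (zeroʳ _)) ⟩
    ι (suc n !) * 0# ∎)
    where
    term : ∀ k m → k ℕ.+ m ≡ suc n →
      ι (suc n !) * (ε k * sech⁻¹ m) ≈ ½ ^ suc n * (parity m * (choose (suc n) k * euler k))
    term k m e = begin
      ι (suc n !) * (euler k * ½ ^ k * invFact k * (parity m * ½ ^ m * invFact m))
        ≈⟨ solve 7 (λ a e h i p g j → a :* (e :* h :* i :* (p :* g :* j)) := h :* g :* (p :* (a :* (i :* j) :* e)))
             refl (ι (suc n !)) _ _ _ _ _ _ ⟩
      ½ ^ k * ½ ^ m * (parity m * (ι (suc n !) * (invFact k * invFact m) * euler k))
        ≈⟨ *-cong (^-homo-* ½ k m) (*-congˡ (*-congʳ (choose-invFact k m e))) ⟨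
      ½ ^ (k ℕ.+ m) * (parity m * (choose (suc n) k * euler k))
        ≡⟨ ≡.cong (λ i → ½ ^ i * (parity m * (choose (suc n) k * euler k))) e ⟩
      ½ ^ suc n * (parity m * (choose (suc n) k * euler k)) ∎

  parity-½ : ∀ n → parity n * ½ ^ n ≈ ½ * (½ ^ n + (- ½) ^ n)
  parity-½ zero          = begin
    1# * 1#          ≈⟨ *-identityˡ 1# ⟩
    1#               ≈⟨ ½+½ ⟨
    ½ + ½            ≈⟨ solve 1 (λ h → h :+ h := h :* (:1 :+ :1)) refl ½ ⟩
    ½ * (1# + 1#)    ∎
  parity-½ (suc zero)    = solve 1 (λ h → :0 :* (h :* :1) := h :* (h :* :1 :+ (:- h) :* :1)) refl ½
  parity-½ (suc (suc n)) = begin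
    parity n * (½ * (½ * ½ ^ n))
      ≈⟨ solve 3 (λ p h q → p :* (h :* (h :* q)) := h :* h :* (p :* q)) refl (parity n) ½ _ ⟩
    ½ * ½ * (parity n * ½ ^ n)
      ≈⟨ *-congˡ (parity-½ n) ⟩
    ½ * ½ * (½ * (½ ^ n + (- ½) ^ n))
      ≈⟨ solve 3 (λ h p q → h :* h :* (h :* (p :+ q)) := h :* (h :* (h :* p) :+ (:- h) :* ((:- h) :* q))) refl ½ _ _ ⟩
    ½ * (½ ^ suc (suc n) + (- ½) ^ suc (suc n)) ∎

  sech⁻¹-exp : sech⁻¹ ≋ conv (const ½) (exp ½ S.+ exp (- ½))
  sech⁻¹-exp n = begin
    parity n * ½ ^ n * invFact n
      ≈⟨ *-congʳ (parity-½ n) ⟩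
    ½ * (½ ^ n + (- ½) ^ n) * invFact n
      ≈⟨ solve 4 (λ h p q i → h :* (p :+ q) :* i := h :* (i :* p :+ i :* q)) refl ½ _ _ _ ⟩
    ½ * (exp ½ n + exp (- ½) n)
      ≈⟨ const-conv ½ _ n ⟨
    conv (const ½) (exp ½ S.+ exp (- ½)) n ∎

  exp-inverse : ∀ c → conv (exp (- c)) (exp c) ≋ const 1#
  exp-inverse c = S.trans (exp-+ (- c) c) (S.trans (exp-cong (-‿inverseˡ c)) exp-0)

  halfExpSucc-conv : halfExpSucc ≋ conv (const ½) (exp 1# S.+ const 1#)
  halfExpSucc-conv n = sym (const-conv ½ _ n)

  -- (e^T + 1)/2 = cosh(T/2) e^{T/2}. This links the Euler numbers, which are centred at ½, to the
  -- denominators e^T + 1 of the partial fractions.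
  halfExpSucc-sech⁻¹ : halfExpSucc ≋ conv sech⁻¹ (exp ½)
  halfExpSucc-sech⁻¹ = S.sym (S.trans (S.*-congʳ sech⁻¹-exp) (S.trans
    (SSolver.solve 3 (λ h p q → h SSolver.:* (p SSolver.:+ q) SSolver.:* p
      SSolver.:= h SSolver.:* (p SSolver.:* p SSolver.:+ q SSolver.:* p)) S.refl (const ½) (exp ½) (exp (- ½)))
    (S.trans (S.*-congˡ {const ½} (S.+-cong (S.trans (exp-+ ½ ½) (exp-cong ½+½)) (exp-inverse ½)))
      (S.sym halfExpSucc-conv))))

  -- 2 / (e^T + 1)
  η : Series
  η = conv ε (exp (- ½))

  η-inv : conv η halfExpSucc ≋ const 1#
  η-inv = S.trans (S.*-congˡ {η} halfExpSucc-sech⁻¹) (S.trans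
    (SSolver.solve 4 (λ p q r s → p SSolver.:* q SSolver.:* (r SSolver.:* s)
      SSolver.:= p SSolver.:* r SSolver.:* (q SSolver.:* s)) S.refl ε (exp (- ½)) sech⁻¹ (exp ½))
    (S.trans (S.*-cong ε-inv (exp-inverse ½)) (S.*-identityˡ (const 1#))))

  -- E_n(x) = n! e_n(x)
  e : Carrier → Series
  e x = conv η (exp x)

  e-ε : ∀ x → e x ≋ conv ε (exp (x − ½))
  e-ε x = S.trans (S.*-assoc ε (exp (- ½)) (exp x))
    (S.*-congˡ {ε} (S.trans (exp-+ (- ½) x) (exp-cong (+-comm (- ½) x))))

  eulerPoly-e : ∀ n x → eulerPoly n x ≈ ι (n !) * e x n
  eulerPoly-e n x = trans (sumCount-anti 0 n term) (trans (anti-* n _ _) (*-congˡ (sym (e-ε x n))))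
    where
    term : ∀ k m → k ℕ.+ m ≡ n → choose n k * (euler k * pow (ι 2) k ⁻¹) * pow (x − ½) (n ∸ k) ≈
      ι (n !) * (ε k * exp (x − ½) m)
    term k m ≡.refl = begin
      choose n k * (euler k * pow (ι 2) k ⁻¹) * pow (x − ½) (n ∸ k)
        ≡⟨ ≡.cong (choose n k * (euler k * pow (ι 2) k ⁻¹) *_)
             (≡.trans (≡.cong (pow (x − ½)) (ℕ.m+n∸m≡n k m)) (pow≡^ (x − ½) m)) ⟩
      choose n k * (euler k * pow (ι 2) k ⁻¹) * (x − ½) ^ m
        ≈⟨ *-congʳ (*-cong (choose-invFact k m ≡.refl) (*-congˡ (pow-2-inverse k))) ⟩
      ι (n !) * (invFact k * invFact m) * (euler k * ½ ^ k) * (x − ½) ^ m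
        ≈⟨ solve 6 (λ a i j b h p → a :* (i :* j) :* (b :* h) :* p := a :* (b :* h :* i :* (j :* p)))
             refl (ι (n !)) _ _ _ _ _ ⟩
      ι (n !) * (ε k * exp (x − ½) m) ∎

-- Reflection y ↦ 1 - y

module Reflection {c ℓ : Level} (F : CharZeroField c ℓ) where
  open CharZeroField F
  open FieldDefs F
  open IntegerSolver commutativeRing
  open PowerSeries commutativeRing
  open CharZeroFieldProperties F
  open FieldSums F
  open FieldSeries F
  open BernoulliSeries F
  open EulerSeries F
  open ScaledIdentities F commutativeRing id (Identity.isRingHomomorphism rawRing refl) β η using (scale-halfExpSucc)
  open Exponentiation commutativeSemiring using (_^_)
  private
    module S = CommutativeRing seriesRing
    module SSolver = IntegerSolver seriesRing
  open CoreIdentities seriesRing using (inverse-unique)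
  open import Relation.Binary.Reasoning.Setoid setoid

  1^ : ∀ n → 1# ^ n ≈ 1#
  1^ zero    = refl
  1^ (suc n) = trans (*-identityˡ _) (1^ n)

  expDiv-reflection : conv (exp 1#) (expDiv (- 1#)) ≋ tail invFact
  expDiv-reflection n = begin
    conv (exp 1#) (expDiv (- 1#)) n
      ≈⟨ conv-comm (exp 1#) (expDiv (- 1#)) n ⟩
    conv (expDiv (- 1#)) (exp 1#) n
      ≈⟨ solve 2 (λ p q → p := q :- (:1 :* q :+ (:- :1) :* p)) refl _ (expDiv 1# n) ⟩
    expDiv 1# n - (1# * expDiv 1# n + (- 1#) * conv (expDiv (- 1#)) (exp 1#) n)
      ≈⟨ +-congˡ (-‿cong (expDiv-+ {u = 0#} {v = - 1#} {w = 1#} (sym (-‿inverseʳ 1#)) n)) ⟨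
    expDiv 1# n - 0# * expDiv 0# n
      ≈⟨ solve 2 (λ p q → p :- :0 :* q := p) refl _ _ ⟩
    invFact (suc n) * 1# ^ n
      ≈⟨ trans (*-congˡ (1^ n)) (*-identityʳ _) ⟩
    invFact (suc n) ∎

  halfExpSucc-reflection : conv (exp 1#) (scale (- 1#) halfExpSucc) ≋ halfExpSucc
  halfExpSucc-reflection = S.trans (S.*-congˡ {exp 1#} (scale-halfExpSucc (- 1#))) (S.trans
    (SSolver.solve 3 (λ h p q → p SSolver.:* (h SSolver.:* (q SSolver.:+ SSolver.:1))
      SSolver.:= h SSolver.:* (p SSolver.:+ q SSolver.:* p)) S.refl (const ½) (exp 1#) (exp (- 1#)))
    (S.trans (S.*-congˡ {const ½} (S.+-congˡ {exp 1#} (exp-inverse 1#))) (S.sym halfExpSucc-conv)))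

  scale-neg-exp : ∀ {p q} → conv p q ≋ const 1# → conv (exp 1#) (scale (- 1#) q) ≋ q →
    ∀ y → conv p (exp (1# − y)) ≋ scale (- 1#) (conv p (exp y))
  scale-neg-exp {p} {q} pq≋1 reflect y = S.sym (S.trans (scale-conv (- 1#) p (exp y)) (S.trans
    (S.*-cong neg (S.trans (scale-exp (- 1#) y) (exp-cong (solve 1 (λ y → y :* (:- :1) := :- y) refl y))))
    (S.trans (S.*-assoc p (exp 1#) (exp (- y))) (S.*-congˡ {p} (exp-+ 1# (- y))))))
    where
    neg : scale (- 1#) p ≋ conv p (exp 1#)
    neg = inverse-unique {scale (- 1#) p} {scale (- 1#) q} (scale-inverse (- 1#) p q pq≋1)
      (S.trans (S.*-assoc p (exp 1#) (scale (- 1#) q)) (S.trans (S.*-congˡ {p} reflect) pq≋1))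

  scale-sign : ∀ p n → scale (- 1#) p n ≈ sign n * p n
  scale-sign p n = trans (*-comm _ _) (*-congʳ (reflexive (≡.sym (pow≡^ (- 1#) n))))

  b-reflection : ∀ y n → b (1# − y) n ≈ sign n * b y n
  b-reflection y n = trans (scale-neg-exp β-inv expDiv-reflection y n) (scale-sign (b y) n)

  e-reflection : ∀ y n → e (1# − y) n ≈ sign n * e y n
  e-reflection y n = trans (scale-neg-exp η-inv halfExpSucc-reflection y n) (scale-sign (e y) n)

-- Elimination of x + y in favour of z

module ReflectedIdentities {c ℓ : Level} (F : CharZeroField c ℓ) where
  open CharZeroField F
  open FieldDefs F
  open IntegerSolver commutativeRing
  open PowerSeries commutativeRing
  open Functional commutativeRing using (Δ)
  open FieldSeries F
  open BernoulliSeries F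
  open EulerSeries F
  open Reflection F
  open FunctionalIdentities F β η using (bernoulli-functional; euler-functional)
  open import Relation.Binary.Reasoning.Setoid setoid

  sign-+ : ∀ k m → sign (k ℕ.+ m) ≈ sign k * sign m
  sign-+ zero    m = sym (*-identityˡ _)
  sign-+ (suc k) m = trans (*-congˡ (sign-+ k m)) (sym (*-assoc _ _ _))

  sign-square : ∀ n → sign n * sign n ≈ 1#
  sign-square zero    = *-identityˡ 1#
  sign-square (suc n) = trans (solve 1 (λ s → (:- :1) :* s :* ((:- :1) :* s) := s :* s) refl (sign n)) (sign-square n)

  module _ {x y z : Carrier} (x+y+z≈1 : x + y + z ≈ 1#) where

    x+y≈1-z : x + y ≈ 1# − z
    x+y≈1-z = trans (solve 3 (λ x y z → x :+ y := x :+ y :+ z :- z) refl x y z) (+-congʳ x+y+z≈1)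

    b-x+y : ∀ m → b (x + y) m ≈ sign m * b z m
    b-x+y m = trans (conv-cong {β} (λ _ → refl) (exp-cong x+y≈1-z) m) (b-reflection z m)

    e-x+y : ∀ m → e (x + y) m ≈ sign m * e z m
    e-x+y m = trans (conv-cong {η} (λ _ → refl) (exp-cong x+y≈1-z) m) (e-reflection z m)

    -- Both factors are reflected, at 1 - y and at x + y = 1 - z, and (-1)^k (-1)^m depends only on
    -- n.
    collect-signs : ∀ n (p q : Series) (w : ℕ → ℕ → Carrier) →
      (∀ m → q m ≈ sign m * p m) →
      anti n (λ k m → b (1# − y) k * q m * w k m) ≈ sign n * anti n (λ k m → b y k * p m * w k m)
    collect-signs n p q w q≈p = trans (anti-cong n step) (anti-* n (sign n) (λ k m → b y k * p m * w k m))
      where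
      step : ∀ k m → k ℕ.+ m ≡ n → b (1# − y) k * q m * w k m ≈ sign n * (b y k * p m * w k m)
      step k m ≡.refl = begin
        b (1# − y) k * q m * w k m
          ≈⟨ *-congʳ (*-cong (b-reflection y k) (q≈p m)) ⟩
        sign k * b y k * (sign m * p m) * w k m
          ≈⟨ solve 5 (λ s b r p w → s :* b :* (r :* p) :* w := s :* r :* (b :* p :* w)) refl (sign k) (b y k) (sign m) (p m) (w k m) ⟩
        sign k * sign m * (b y k * p m * w k m)
          ≈⟨ *-congʳ (sign-+ k m) ⟨
        sign (k ℕ.+ m) * (b y k * p m * w k m) ∎

    -- Only the second factor is reflected, so the sign stays inside the sum; reflecting a falling
    -- factorial disposes of it later.
    pull-sign : ∀ n (p q : Series) (w : ℕ → Carrier) →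
      (∀ m → q m ≈ sign m * p m) →
      anti n (λ k m → b x k * q m * w k) ≈ anti n (λ k m → sign m * (b x k * p m * w k))
    pull-sign n p q w q≈p = anti-cong n (λ k m _ → trans (*-congʳ (*-congˡ (q≈p m)))
      (solve 4 (λ b s p w → b :* (s :* p) :* w := s :* (b :* p :* w)) refl (b x k) (sign m) (p m) (w k)))

    bernoulli-reflected : ∀ l n →
      anti n (λ k m → b x k * b y m * (l (suc k) - l k)) ≈
      anti n (λ k m → sign m * (b x k * b z m * Δ k l 1)) - sign n * anti n (λ k m → b y k * b z m * Δ k l m)
    bernoulli-reflected l n = trans (bernoulli-functional β-inv l x y n)
      (+-cong (pull-sign n (b z) (b (x + y)) (λ k → Δ k l 1) b-x+y)
        (-‿cong (collect-signs n (b z) (b (x + y)) (λ k m → Δ k l m) b-x+y)))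

    euler-reflected : ∀ l n →
      ½ * anti n (λ k m → e x k * e y m * (l (suc k) - l k)) ≈
      sign (suc n) * anti (suc n) (λ k m → b y k * e z m * Δ k l m)
        - anti (suc n) (λ k m → sign m * (b x k * e z m * Δ k l 0))
    euler-reflected l n = trans (euler-functional β-inv η-inv l x y n)
      (+-cong (collect-signs (suc n) (e z) (e (x + y)) (λ k m → Δ k l m) e-x+y)
        (-‿cong (pull-sign (suc n) (e z) (e (x + y)) (λ k → Δ k l 0) e-x+y)))

-- Falling factorials and weights whose differences have closed forms

module FallingFactorials {c ℓ : Level} (F : CharZeroField c ℓ) where
  open CharZeroField F
  open FieldDefs F
  open IntegerSolver commutativeRing
  open CharZeroFieldProperties F
  open Functional commutativeRing using (Δ)
  open import Relation.Binary.Reasoning.Setoid setoid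

  falling-cong : ∀ {y z} k → y ≈ z → falling y k ≈ falling z k
  falling-cong zero    y≈z = refl
  falling-cong (suc k) y≈z = *-cong (falling-cong k y≈z) (+-congʳ y≈z)

  falling-+ : ∀ z a b → falling z (a ℕ.+ b) ≈ falling z a * falling (z − ι a) b
  falling-+ z a zero    = trans (reflexive (≡.cong (falling z) (ℕ.+-identityʳ a))) (sym (*-identityʳ _))
  falling-+ z a (suc b) = begin
    falling z (a ℕ.+ suc b)
      ≡⟨ ≡.cong (falling z) (ℕ.+-suc a b) ⟩
    falling z (a ℕ.+ b) * (z − ι (a ℕ.+ b))
      ≈⟨ *-cong (falling-+ z a b) (+-congˡ (-‿cong (ι-+ a b))) ⟩
    falling z a * falling (z − ι a) b * (z − (ι a + ι b))
      ≈⟨ solve 5 (λ p q z a b → p :* q :* (z :- (a :+ b)) := p :* (q :* (z :- a :- b))) refl _ _ z (ι a) (ι b) ⟩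
    falling z a * falling (z − ι a) (suc b) ∎

  falling-1 : ∀ z → falling z 1 ≈ z
  falling-1 z = solve 1 (λ z → :1 :* (z :- :0) := z) refl z

  falling-suc : ∀ z b → falling z (suc b) ≈ z * falling (z − 1#) b
  falling-suc z b = trans (falling-+ z 1 b)
    (*-cong (falling-1 z) (falling-cong b (+-congˡ (-‿cong (+-identityʳ 1#)))))

  falling-reflection : ∀ z k → falling z k ≈ sign k * falling (ι k − 1# − z) k
  falling-reflection z zero    = sym (*-identityˡ 1#)
  falling-reflection z (suc k) = begin
    falling z k * (z − ι k)
      ≈⟨ *-congʳ (falling-reflection z k) ⟩
    sign k * falling (ι k − 1# − z) k * (z − ι k)
      ≈⟨ solve 4 (λ s p z a → s :* p :* (z :- a) := (:- :1) :* s :* ((a :- z) :* p)) refl (sign k) _ z (ι k) ⟩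
    sign (suc k) * ((ι k − z) * falling (ι k − 1# − z) k)
      ≈⟨ *-congˡ (*-cong (solve 2 (λ a z → a :- z := :1 :+ a :- :1 :- z) refl (ι k) z)
           (falling-cong k (solve 2 (λ a z → a :- :1 :- z := :1 :+ a :- :1 :- z :- :1) refl (ι k) z))) ⟩
    sign (suc k) * ((ι (suc k) − 1# − z) * falling (ι (suc k) − 1# − z − 1#) k)
      ≈⟨ *-congˡ (falling-suc (ι (suc k) − 1# − z) k) ⟨
    sign (suc k) * falling (ι (suc k) − 1# − z) (suc k) ∎

  -- For i ≤ n this is n! C(t,i)/C(n,i). Its first difference is, up to the constant factor t - n,
  -- the weight that C(t,k) puts on the normalised coefficients e_k(x) e_m(y).
  factorialWeight : Carrier → ℕ → ℕ → Carrier
  factorialWeight t n i = falling t i * ι ((n ∸ i) !)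

  -- The distance b = n - k - a is carried as an index. The inductive step comes down to (t - a) -
  -- (b + 1) = t - (a + b + 1), the leading factor of the longer falling factorial.
  Δ-factorialWeight : ∀ t n k a b → k ℕ.+ (a ℕ.+ b) ≡ n →
    Δ k (factorialWeight t n) a ≈ falling t a * ι (b !) * falling (t − ι (suc (a ℕ.+ b))) k
  Δ-factorialWeight t n zero    a b ≡.refl =
    trans (*-congˡ (reflexive (≡.cong (λ i → ι (i !)) (ℕ.m+n∸m≡n a b)))) (sym (*-identityʳ _))
  Δ-factorialWeight t n (suc k) a b eq = begin
    Δ k (factorialWeight t n) (suc a) - Δ k (factorialWeight t n) a
      ≈⟨ +-cong (Δ-factorialWeight t n k (suc a) b (≡.trans (ℕ.+-suc k (a ℕ.+ b)) eq))
           (-‿cong (Δ-factorialWeight t n k a (suc b)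
             (≡.trans (≡.cong (k ℕ.+_) (ℕ.+-suc a b)) (≡.trans (ℕ.+-suc k (a ℕ.+ b)) eq)))) ⟩
    falling t a * (t − ι a) * ι (b !) * falling (t − ι (suc (suc a ℕ.+ b))) k
      - falling t a * ι (suc b !) * falling (t − ι (suc (a ℕ.+ suc b))) k
      ≈⟨ +-cong (*-congˡ (falling-cong k below)) (-‿cong (*-cong (*-congˡ (ι-* (suc b) (b !)))
           (falling-cong k (trans (+-congˡ (-‿cong (reflexive (≡.cong (λ i → ι (suc i)) (ℕ.+-suc a b))))) below)))) ⟩
    falling t a * (t − ι a) * ι (b !) * falling (s − 1#) k
      - falling t a * (ι (suc b) * ι (b !)) * falling (s − 1#) k
      ≈⟨ solve 6 (λ p t a q b r → p :* (t :- a) :* q :* r :- p :* ((:1 :+ b) :* q) :* r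
           := p :* q :* ((t :- (:1 :+ (a :+ b))) :* r)) refl (falling t a) t (ι a) (ι (b !)) (ι b) (falling (s − 1#) k) ⟩
    falling t a * ι (b !) * ((t − (1# + (ι a + ι b))) * falling (s − 1#) k)
      ≈⟨ *-congˡ (*-congʳ (+-congˡ (-‿cong (+-congˡ (ι-+ a b))))) ⟨
    falling t a * ι (b !) * (s * falling (s − 1#) k)
      ≈⟨ *-congˡ (falling-suc s k) ⟨
    falling t a * ι (b !) * falling s (suc k) ∎
    where
    s : Carrier
    s = t − ι (suc (a ℕ.+ b))
    below : t − ι (suc (suc (a ℕ.+ b))) ≈ s − 1#
    below = solve 2 (λ t i → t :- (:1 :+ i) := t :- i :- :1) refl t (ι (suc (a ℕ.+ b)))

  sumCount-last : ∀ a m f → sumCount a (suc m) f ≈ sumCount a m f + f (a ℕ.+ m)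
  sumCount-last a zero    f = trans (+-comm _ _) (+-congˡ (reflexive (≡.cong f (≡.sym (ℕ.+-identityʳ a)))))
  sumCount-last a (suc m) f = trans (+-congˡ (sumCount-last (suc a) m f))
    (trans (sym (+-assoc _ _ _)) (+-congˡ (reflexive (≡.cong f (≡.sym (ℕ.+-suc a m))))))

  reciprocal : Carrier → ℕ → Carrier
  reciprocal t k = (t − ι k) ⁻¹

  −-nonZero : ∀ {t s} → ¬ (t ≈ s) → ¬ (t − s ≈ 0#)
  −-nonZero {t} {s} t≉s t−s≈0 = t≉s (begin
    t             ≈⟨ solve 2 (λ t s → t := t :- s :+ s) refl t s ⟩
    t − s + s     ≈⟨ +-congʳ t−s≈0 ⟩
    0# + s        ≈⟨ +-identityˡ s ⟩
    s             ∎)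

  -- The factor `falling t n` clears the denominators t - j with j < n. The constant h is invisible
  -- to differences and serves to make the weight vanish at a prescribed index.
  harmonicWeight : Carrier → ℕ → Carrier → ℕ → Carrier
  harmonicWeight t n h i = falling t n * (sumCount 0 i (reciprocal t) − h)

  harmonicWeight-step : ∀ t n h k →
    harmonicWeight t n h (suc k) - harmonicWeight t n h k ≈ falling t n * reciprocal t k
  harmonicWeight-step t n h k = trans (+-congʳ (*-congˡ (+-congʳ (sumCount-last 0 k (reciprocal t)))))
    (solve 4 (λ a s r h → a :* (s :+ r :- h) :- a :* (s :- h) := a :* r) refl _ _ _ h)

  -- The k-th difference of a ↦ 1/(t - a) is k!/((t - a)⋯(t - a - k)). Its denominator is a block of
  -- consecutive factors of `falling t n`, and removing it leaves the two falling factorials on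
  -- either side.
  Δ-harmonicWeight : ∀ t n h → (∀ k → k < n → ¬ (t ≈ ι k)) → ∀ k a b → suc k ℕ.+ (a ℕ.+ b) ≡ n →
    Δ (suc k) (harmonicWeight t n h) a ≈ ι (k !) * falling t a * falling (t − ι (suc (a ℕ.+ k))) b
  Δ-harmonicWeight t n h t≉ zero a b ≡.refl = begin
    harmonicWeight t n h (suc a) - harmonicWeight t n h a
      ≈⟨ harmonicWeight-step t n h a ⟩
    falling t (suc a ℕ.+ b) * reciprocal t a
      ≈⟨ *-congʳ (falling-+ t (suc a) b) ⟩
    falling t a * (t − ι a) * falling (t − ι (suc a)) b * reciprocal t a
      ≈⟨ solve 4 (λ p d q r → p :* d :* q :* r := d :* r :* (p :* q)) refl _ _ _ _ ⟩
    (t − ι a) * reciprocal t a * (falling t a * falling (t − ι (suc a)) b)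
      ≈⟨ *-congʳ (⁻¹-inverse _ (−-nonZero (t≉ a (s≤s (ℕ.m≤m+n a b))))) ⟩
    1# * (falling t a * falling (t − ι (suc a)) b)
      ≈⟨ trans (solve 2 (λ p q → :1 :* (p :* q) := (:1 :+ :0) :* p :* q) refl _ _)
           (*-congˡ (falling-cong b (+-congˡ (-‿cong (reflexive (≡.cong (λ i → ι (suc i)) (≡.sym (ℕ.+-identityʳ a)))))))) ⟩
    ι 1 * falling t a * falling (t − ι (suc (a ℕ.+ 0))) b ∎
  Δ-harmonicWeight t n h t≉ (suc k) a b eq = begin
    Δ (suc k) (harmonicWeight t n h) (suc a) - Δ (suc k) (harmonicWeight t n h) a
      ≈⟨ +-cong (Δ-harmonicWeight t n h t≉ k (suc a) b (≡.trans (ℕ.+-suc (suc k) (a ℕ.+ b)) eq))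
           (-‿cong (Δ-harmonicWeight t n h t≉ k a (suc b)
             (≡.trans (≡.cong (suc k ℕ.+_) (ℕ.+-suc a b)) (≡.trans (ℕ.+-suc (suc k) (a ℕ.+ b)) eq)))) ⟩
    ι (k !) * (falling t a * (t − ι a)) * falling (t − ι (suc (suc a ℕ.+ k))) b
      - ι (k !) * falling t a * falling s (suc b)
      ≈⟨ +-cong (*-congˡ (falling-cong b below)) (-‿cong (*-congˡ (falling-suc s b))) ⟩
    ι (k !) * (falling t a * (t − ι a)) * falling (s − 1#) b - ι (k !) * falling t a * (s * falling (s − 1#) b)
      ≈⟨ +-congˡ (-‿cong (*-congˡ (*-congʳ (+-congˡ (-‿cong (+-congˡ (ι-+ a k))))))) ⟩
    ι (k !) * (falling t a * (t − ι a)) * falling (s − 1#) b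
      - ι (k !) * falling t a * ((t − (1# + (ι a + ι k))) * falling (s − 1#) b)
      ≈⟨ solve 6 (λ q p t a k r → q :* (p :* (t :- a)) :* r :- q :* p :* ((t :- (:1 :+ (a :+ k))) :* r)
           := (:1 :+ k) :* q :* p :* r) refl (ι (k !)) (falling t a) t (ι a) (ι k) (falling (s − 1#) b) ⟩
    ι (suc k) * ι (k !) * falling t a * falling (s − 1#) b
      ≈⟨ *-cong (*-congʳ (sym (ι-* (suc k) (k !))))
           (falling-cong b (trans (sym below) (+-congˡ (-‿cong (reflexive (≡.cong (λ i → ι (suc i)) (≡.sym (ℕ.+-suc a k)))))))) ⟩
    ι (suc k !) * falling t a * falling (t − ι (suc (a ℕ.+ suc k))) b ∎
    where
    s : Carrier
    s = t − ι (suc (a ℕ.+ k))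
    below : t − ι (suc (suc (a ℕ.+ k))) ≈ s − 1#
    below = solve 2 (λ t i → t :- (:1 :+ i) := t :- i :- :1) refl t (ι (suc (a ℕ.+ k)))

-- Sums of polynomials expressed in normalised coefficients

module WeightedSums {c ℓ : Level} (F : CharZeroField c ℓ) where
  open CharZeroField F
  open FieldDefs F
  open IntegerSolver commutativeRing
  open PowerSeries commutativeRing
  open CharZeroFieldProperties F
  open CoreIdentities commutativeRing using (insert)
  open FieldSums F
  open import Relation.Binary.Reasoning.Setoid setoid

  module _ {p q P Q : Series} (p≈ : ∀ k → p k ≈ ι (k !) * P k) (q≈ : ∀ k → q k ≈ ι (k !) * Q k) where

    -- The denominator k! of the binomial cancels against the k! in p, while the m! in q survives.
    binom-sum : ∀ s n → (∑[ k ∈ 0 ⋯ n ] (binom s k * p k * q (n ∸ k))) ≈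
      anti n (λ k m → falling s k * ι (m !) * (P k * Q m))
    binom-sum s n = sumCount-anti 0 n term
      where
      term : ∀ k m → k ℕ.+ m ≡ n → binom s k * p k * q (n ∸ k) ≈ falling s k * ι (m !) * (P k * Q m)
      term k m ≡.refl = begin
        binom s k * p k * q (k ℕ.+ m ∸ k)
          ≡⟨ ≡.cong (λ i → binom s k * p k * q i) (ℕ.m+n∸m≡n k m) ⟩
        binom s k * p k * q m
          ≈⟨ *-cong (*-congˡ (p≈ k)) (q≈ m) ⟩
        falling s k * invFact k * (ι (k !) * P k) * (ι (m !) * Q m)
          ≈⟨ solve 6 (λ f i a P b Q → f :* i :* (a :* P) :* (b :* Q) := a :* i :* (f :* b :* (P :* Q)))
               refl (falling s k) (invFact k) (ι (k !)) (P k) (ι (m !)) (Q m) ⟩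
        ι (k !) * invFact k * (falling s k * ι (m !) * (P k * Q m))
          ≈⟨ insert (!-invFact k) _ ⟨
        falling s k * ι (m !) * (P k * Q m) ∎

    -- Only the n! of the binomial coefficient survives; w will carry the reciprocals 1/(t - k).
    choose-sum : ∀ (w : Series) n → (∑[ k ∈ 0 ⋯ n ] (choose n k * (p k * w k) * q (n ∸ k))) ≈
      ι (n !) * anti n (λ k m → P k * w k * Q m)
    choose-sum w n = trans (sumCount-anti 0 n term) (anti-* n (ι (n !)) (λ k m → P k * w k * Q m))
      where
      term : ∀ k m → k ℕ.+ m ≡ n → choose n k * (p k * w k) * q (n ∸ k) ≈ ι (n !) * (P k * w k * Q m)
      term k m ≡.refl = begin
        choose n k * (p k * w k) * q (k ℕ.+ m ∸ k)
          ≡⟨ ≡.cong (λ i → choose n k * (p k * w k) * q i) (ℕ.m+n∸m≡n k m) ⟩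
        choose n k * (p k * w k) * q m
          ≈⟨ *-cong (*-cong (choose-invFact k m ≡.refl) (*-congʳ (p≈ k))) (q≈ m) ⟩
        ι (n !) * (invFact k * invFact m) * (ι (k !) * P k * w k) * (ι (m !) * Q m)
          ≈⟨ solve 8 (λ n i j a P w b Q → n :* (i :* j) :* (a :* P :* w) :* (b :* Q)
               := a :* i :* (b :* j :* (n :* (P :* w :* Q))))
               refl (ι (n !)) (invFact k) (invFact m) (ι (k !)) (P k) (w k) (ι (m !)) (Q m) ⟩
        ι (k !) * invFact k * (ι (m !) * invFact m * (ι (n !) * (P k * w k * Q m)))
          ≈⟨ trans (insert (!-invFact m) _) (insert (!-invFact k) _) ⟨
        ι (n !) * (P k * w k * Q m) ∎

    -- The index is shifted so that k + 1 is the original one; then (k+1)!/(k+1) leaves k!, matching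
    -- the factorial in `Δ-harmonicWeight`.
    quotient-sum : ∀ s n → (∑[ k ∈ 1 ⋯ suc n ] (binom s (suc n ∸ k) * (p k * ι k ⁻¹) * q (suc n ∸ k))) ≈
      anti n (λ k m → ι (k !) * falling s m * (P (suc k) * Q m))
    quotient-sum s n = sumCount-anti 1 n term
      where
      term : ∀ k m → k ℕ.+ m ≡ n →
        binom s (n ∸ k) * (p (suc k) * ι (suc k) ⁻¹) * q (n ∸ k) ≈ ι (k !) * falling s m * (P (suc k) * Q m)
      term k m ≡.refl = begin
        binom s (k ℕ.+ m ∸ k) * (p (suc k) * ι (suc k) ⁻¹) * q (k ℕ.+ m ∸ k)
          ≡⟨ ≡.cong (λ i → binom s i * (p (suc k) * ι (suc k) ⁻¹) * q i) (ℕ.m+n∸m≡n k m) ⟩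
        binom s m * (p (suc k) * ι (suc k) ⁻¹) * q m
          ≈⟨ *-cong (*-congˡ (*-congʳ (trans (p≈ (suc k)) (*-congʳ (ι-* (suc k) (k !)))))) (q≈ m) ⟩
        falling s m * invFact m * (ι (suc k) * ι (k !) * P (suc k) * ι (suc k) ⁻¹) * (ι (m !) * Q m)
          ≈⟨ solve 8 (λ f i c a P r b Q → f :* i :* (c :* a :* P :* r) :* (b :* Q)
               := c :* r :* (b :* i :* (a :* f :* (P :* Q))))
               refl (falling s m) (invFact m) (ι (suc k)) (ι (k !)) (P (suc k)) (ι (suc k) ⁻¹) (ι (m !)) (Q m) ⟩
        ι (suc k) * ι (suc k) ⁻¹ * (ι (m !) * invFact m * (ι (k !) * falling s m * (P (suc k) * Q m)))
          ≈⟨ trans (insert (!-invFact m) _) (insert (⁻¹-inverse _ (charZero k)) _) ⟨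
        ι (k !) * falling s m * (P (suc k) * Q m) ∎

-- The three identities

module SunPan {c ℓ : Level} (F : CharZeroField c ℓ) where
  open CharZeroField F
  open FieldDefs F
  open IntegerSolver commutativeRing
  open PowerSeries commutativeRing
  open Functional commutativeRing using (Δ)
  open CharZeroFieldProperties F
  open CoreIdentities commutativeRing using (insert)
  open BernoulliSeries F
  open EulerSeries F
  open ReflectedIdentities F
  open FallingFactorials F
  open WeightedSums F
  open import Relation.Binary.Reasoning.Setoid setoid

  module _ {x y z : Carrier} (t : Carrier) (x+y+z≈1 : x + y + z ≈ 1#) where

    r : Series
    r = reciprocal t

    b≈ : ∀ x k → bernoulliPoly k x ≈ ι (k !) * b x k
    b≈ x k = bernoulliPoly-b k x

    e≈ : ∀ x k → eulerPoly k x ≈ ι (k !) * e x k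
    e≈ x k = eulerPoly-e k x

    -- Absorbs the sign left inside a sum by `pull-sign`; in its uses the reflected argument u no
    -- longer depends on the summation index.
    sign-falling : ∀ m {s} u → ι m − 1# − s ≈ u → sign m * falling s m ≈ falling u m
    sign-falling m {s} u eq = begin
      sign m * falling s m                              ≈⟨ *-congˡ (trans (falling-reflection s m) (*-congˡ (falling-cong m eq))) ⟩
      sign m * (sign m * falling u m)                   ≈⟨ *-assoc _ _ _ ⟨
      sign m * sign m * falling u m                     ≈⟨ insert (sign-square m) _ ⟨
      falling u m                                       ∎

    binom-falling : ∀ s n → binom s n * ι (n !) ≈ falling s n
    binom-falling s n = trans (solve 3 (λ f i a → f :* i :* a := a :* i :* f) refl _ _ _) (sym (insert (!-invFact n) _))

    b-0 : ∀ x → b x 0 ≈ 1#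
    b-0 x = begin
      1# * invFact 0 * (invFact 0 * 1#)   ≈⟨ *-cong (*-congˡ invFact-0) (*-congʳ invFact-0) ⟩
      1# * 1# * (1# * 1#)                 ≈⟨ solve 0 (:1 :* :1 :* (:1 :* :1) := :1) refl ⟩
      1#                                  ∎

    module Factorial (n : ℕ) (t≉ : ∀ k → k ≤ suc n → ¬ (t ≈ ι k)) where
      N : ℕ
      N = suc n
      A τ S₁ S₂ S₃ : Carrier
      A = falling t N
      τ = t − ι N
      S₁ = anti n (λ k m → falling t k * ι (m !) * (e x k * e y m))
      S₂ = anti N (λ k m → b y k * e z m * r m)
      S₃ = anti N (λ k m → falling (ι N − t) k * ι (m !) * (b x k * e z m))
      l : Series
      l = factorialWeight t N

      term₁ : ∀ k m → k ℕ.+ m ≡ n →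
        e x k * e y m * (l (suc k) - l k) ≈ τ * (falling t k * ι (m !) * (e x k * e y m))
      term₁ k m ≡.refl = trans
        (*-congˡ (trans (Δ-factorialWeight t N 1 k m ≡.refl) (*-congˡ (falling-1 _))))
        (solve 5 (λ x y f a τ → x :* y :* (f :* a :* τ) := τ :* (f :* a :* (x :* y)))
          refl (e x k) (e y m) (falling t k) (ι (m !)) τ)

      -- As k + m = N, the two falling factorials together contain every factor of t(t-1)⋯(t-N)
      -- except t - m. Restoring that factor is what creates the reciprocal.
      weight₂ : ∀ k m → k ℕ.+ m ≡ N → Δ k l m ≈ A * τ * r m
      weight₂ k m eq = begin
        Δ k l m
          ≈⟨ Δ-factorialWeight t N k m 0 (≡.trans (≡.cong (k ℕ.+_) (ℕ.+-identityʳ m)) eq) ⟩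
        falling t m * ι 1 * falling (t − ι (suc (m ℕ.+ 0))) k
          ≈⟨ *-cong (trans (*-congˡ (+-identityʳ 1#)) (*-identityʳ _))
               (falling-cong k (+-congˡ (-‿cong (reflexive (≡.cong (λ i → ι (suc i)) (ℕ.+-identityʳ m)))))) ⟩
        falling t m * falling (t − ι (suc m)) k
          ≈⟨ insert (⁻¹-inverse _ (−-nonZero (t≉ m (≡.subst (m ≤_) eq (ℕ.m≤n+m m k))))) _ ⟩
        (t − ι m) * r m * (falling t m * falling (t − ι (suc m)) k)
          ≈⟨ solve 4 (λ d r p q → d :* r :* (p :* q) := p :* d :* q :* r) refl (t − ι m) (r m) _ _ ⟩
        falling t m * (t − ι m) * falling (t − ι (suc m)) k * r m
          ≈⟨ *-congʳ (falling-+ t (suc m) k) ⟨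
        falling t (suc m ℕ.+ k) * r m
          ≡⟨ ≡.cong (λ i → falling t (suc i) * r m) (≡.trans (ℕ.+-comm m k) eq) ⟩
        A * τ * r m ∎

      term₂ : ∀ k m → k ℕ.+ m ≡ N → b y k * e z m * Δ k l m ≈ A * τ * (b y k * e z m * r m)
      term₂ k m eq = trans (*-congˡ (weight₂ k m eq))
        (solve 3 (λ p a r → p :* (a :* r) := a :* (p :* r)) refl _ (A * τ) (r m))

      term₃ : ∀ k m → k ℕ.+ m ≡ N → sign m * (b x k * e z m * Δ k l 0) ≈
        sign N * (falling (ι N − t) k * ι (m !) * (b x k * e z m))
      term₃ k m eq = begin
        sign m * (b x k * e z m * Δ k l 0)
          ≈⟨ *-congˡ (*-congˡ (Δ-factorialWeight t N k 0 m eq)) ⟩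
        sign m * (b x k * e z m * (1# * ι (m !) * falling (t − ι (suc m)) k))
          -- Reflection makes the argument N - t, independent of k, and its (-1)^k completes (-1)^m
          -- to (-1)^N.
          ≈⟨ *-congˡ (*-congˡ (*-congˡ (falling-reflection _ k))) ⟩
        sign m * (b x k * e z m * (1# * ι (m !) * (sign k * falling (ι k − 1# − (t − ι (suc m))) k)))
          ≈⟨ *-congˡ (*-congˡ (*-congˡ (*-congˡ (falling-cong k argument)))) ⟩
        sign m * (b x k * e z m * (1# * ι (m !) * (sign k * falling (ι N − t) k)))
          ≈⟨ solve 5 (λ s p a r f → s :* (p :* (:1 :* a :* (r :* f))) := r :* s :* (f :* a :* p))
               refl (sign m) (b x k * e z m) (ι (m !)) (sign k) (falling (ι N − t) k) ⟩
        sign k * sign m * (falling (ι N − t) k * ι (m !) * (b x k * e z m))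
          ≈⟨ *-congʳ (trans (reflexive (≡.cong sign (≡.sym eq))) (sign-+ k m)) ⟨
        sign N * (falling (ι N − t) k * ι (m !) * (b x k * e z m)) ∎
        where
        argument : ι k − 1# − (t − ι (suc m)) ≈ ι N − t
        argument = begin
          ι k − 1# − (t − (1# + ι m))   ≈⟨ solve 3 (λ k m t → k :- :1 :- (t :- (:1 :+ m)) := k :+ m :- t) refl (ι k) (ι m) t ⟩
          ι k + ι m − t                 ≈⟨ +-congʳ (ι-+ k m) ⟨
          ι (k ℕ.+ m) − t               ≡⟨ ≡.cong (λ i → ι i − t) eq ⟩
          ι N − t                       ∎

      identity : ½ * (τ * S₁) ≈ sign N * (A * τ * S₂) - sign N * S₃
      identity = begin
        ½ * (τ * S₁)
          ≈⟨ *-congˡ (trans (anti-cong n term₁) (anti-* n τ _)) ⟨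
        ½ * anti n (λ k m → e x k * e y m * (l (suc k) - l k))
          ≈⟨ euler-reflected x+y+z≈1 l n ⟩
        sign N * anti N (λ k m → b y k * e z m * Δ k l m) - anti N (λ k m → sign m * (b x k * e z m * Δ k l 0))
          ≈⟨ +-cong (*-congˡ (trans (anti-cong N term₂) (anti-* N (A * τ) (λ k m → b y k * e z m * r m))))
               (-‿cong (trans (anti-cong N term₃)
                 (anti-* N (sign N) (λ k m → falling (ι N − t) k * ι (m !) * (b x k * e z m))))) ⟩
        sign N * (A * τ * S₂) - sign N * S₃ ∎

      euler-euler-sum :
        sign N * ½ * (∑[ k ∈ 0 ⋯ n ] (binom t k * eulerPoly k x * eulerPoly (n ∸ k) y))
        ≈ (ι N − t) ⁻¹ * (∑[ k ∈ 0 ⋯ N ] (binom (ι N − t) k * bernoulliPoly k x * eulerPoly (N ∸ k) z))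
          + binom t N * (∑[ k ∈ 0 ⋯ N ] (choose N k * (eulerPoly k z * (t − ι k) ⁻¹) * bernoulliPoly (N ∸ k) y))
      euler-euler-sum = begin
        sign N * ½ * (∑[ k ∈ 0 ⋯ n ] (binom t k * eulerPoly k x * eulerPoly (n ∸ k) y))
          ≈⟨ *-congˡ (binom-sum (e≈ x) (e≈ y) t n) ⟩
        sign N * ½ * S₁
          -- In `identity` every term but the one with S₃ carries τ = -d, so cancelling d leaves a
          -- reciprocal in front of S₃ only.
          ≈⟨ *-cancelˡ d≉0 cleared ⟩
        d ⁻¹ * S₃ + A * S₂
          ≈⟨ +-cong (*-congˡ (binom-sum (b≈ x) (e≈ z) (ι N − t) N)) sum₂ ⟨
        d ⁻¹ * (∑[ k ∈ 0 ⋯ N ] (binom (ι N − t) k * bernoulliPoly k x * eulerPoly (N ∸ k) z))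
          + binom t N * (∑[ k ∈ 0 ⋯ N ] (choose N k * (eulerPoly k z * (t − ι k) ⁻¹) * bernoulliPoly (N ∸ k) y)) ∎
        where
        d : Carrier
        d = ι N − t
        d≉0 : ¬ (d ≈ 0#)
        d≉0 = −-nonZero (λ N≈t → t≉ N ℕ.≤-refl (sym N≈t))
        sum₂ : binom t N * (∑[ k ∈ 0 ⋯ N ] (choose N k * (eulerPoly k z * (t − ι k) ⁻¹) * bernoulliPoly (N ∸ k) y)) ≈ A * S₂
        sum₂ = trans (*-congˡ (choose-sum (e≈ z) (b≈ y) r N)) (trans (sym (*-assoc _ _ _))
          (*-cong (binom-falling t N) (trans (anti-swap N (λ k m → e z k * r k * b y m))
            (anti-cong N (λ k m _ → solve 3 (λ e r b → e :* r :* b := b :* e :* r) refl (e z m) (r m) (b y k))))))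
        cleared : d * (sign N * ½ * S₁) ≈ d * (d ⁻¹ * S₃ + A * S₂)
        cleared = begin
          (ι N − t) * (sign N * ½ * S₁)
            ≈⟨ solve 5 (λ m t s h u → (m :- t) :* (s :* h :* u) := :- s :* (h :* ((t :- m) :* u))) refl (ι N) t (sign N) ½ S₁ ⟩
          - sign N * (½ * (τ * S₁))
            ≈⟨ *-congˡ identity ⟩
          - sign N * (sign N * (A * τ * S₂) - sign N * S₃)
            ≈⟨ solve 6 (λ s a m t p q → :- s :* (s :* (a :* (t :- m) :* p) :- s :* q)
                 := s :* s :* (q :+ (m :- t) :* (a :* p))) refl (sign N) A (ι N) t S₂ S₃ ⟩
          sign N * sign N * (S₃ + d * (A * S₂))
            ≈⟨ insert (sign-square N) _ ⟨
          S₃ + d * (A * S₂)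
            ≈⟨ +-congʳ (insert (⁻¹-inverse d d≉0) S₃) ⟩
          d * d ⁻¹ * S₃ + d * (A * S₂)
            ≈⟨ solve 4 (λ d i p q → d :* i :* p :+ d :* q := d :* (i :* p :+ q)) refl d (d ⁻¹) S₃ (A * S₂) ⟩
          d * (d ⁻¹ * S₃ + A * S₂) ∎

    module HarmonicEuler (n : ℕ) (t≉ : ∀ k → k < suc n → ¬ (t ≈ ι k)) where
      N : ℕ
      N = suc n
      A H S₁ S₂ S₃ : Carrier
      A = falling t N
      H = sumCount 0 N r
      S₁ = anti n (λ k m → e x k * r k * e y m)
      S₂ = anti n (λ k m → ι (k !) * falling t m * (b y (suc k) * e z m))
      S₃ = anti n (λ k m → ι (k !) * falling (ι n − t) m * (b x (suc k) * e z m))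
      l : Series
      -- With h = 0 the weight vanishes at 0, where the differences in the sum over `b x` are taken,
      -- so that sum loses its k = 0 term.
      l = harmonicWeight t N 0#

      term₁ : ∀ k m → k ℕ.+ m ≡ n → e x k * e y m * (l (suc k) - l k) ≈ A * (e x k * r k * e y m)
      term₁ k m _ = trans (*-congˡ (harmonicWeight-step t N 0# k))
        (solve 4 (λ x y a r → x :* y :* (a :* r) := a :* (x :* r :* y)) refl (e x k) (e y m) A (r k))

      term₂ : ∀ k m → k ℕ.+ m ≡ n →
        b y (suc k) * e z m * Δ (suc k) l m ≈ ι (k !) * falling t m * (b y (suc k) * e z m)
      term₂ k m eq = trans (*-congˡ (Δ-harmonicWeight t N 0# t≉ k m 0
          (≡.cong suc (≡.trans (≡.cong (k ℕ.+_) (ℕ.+-identityʳ m)) eq))))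
        (solve 3 (λ p a f → p :* (a :* f :* :1) := a :* f :* p) refl _ (ι (k !)) (falling t m))

      term₃ : ∀ k m → k ℕ.+ m ≡ n → sign m * (b x (suc k) * e z m * Δ (suc k) l 0) ≈
        ι (k !) * falling (ι n − t) m * (b x (suc k) * e z m)
      term₃ k m eq = begin
        sign m * (b x (suc k) * e z m * Δ (suc k) l 0)
          ≈⟨ *-congˡ (*-congˡ (Δ-harmonicWeight t N 0# t≉ k 0 m (≡.cong suc eq))) ⟩
        sign m * (b x (suc k) * e z m * (ι (k !) * 1# * falling (t − ι (suc k)) m))
          ≈⟨ solve 4 (λ s p a f → s :* (p :* (a :* :1 :* f)) := a :* (s :* f) :* p)
               refl (sign m) (b x (suc k) * e z m) (ι (k !)) (falling (t − ι (suc k)) m) ⟩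
        ι (k !) * (sign m * falling (t − ι (suc k)) m) * (b x (suc k) * e z m)
          ≈⟨ *-congʳ (*-congˡ (sign-falling m (ι n − t) argument)) ⟩
        ι (k !) * falling (ι n − t) m * (b x (suc k) * e z m) ∎
        where
        argument : ι m − 1# − (t − ι (suc k)) ≈ ι n − t
        argument = begin
          ι m − 1# − (t − (1# + ι k))   ≈⟨ solve 3 (λ k m t → m :- :1 :- (t :- (:1 :+ k)) := k :+ m :- t) refl (ι k) (ι m) t ⟩
          ι k + ι m − t                 ≈⟨ +-congʳ (ι-+ k m) ⟨
          ι (k ℕ.+ m) − t               ≡⟨ ≡.cong (λ i → ι i − t) eq ⟩
          ι n − t                       ∎

      identity : ½ * (A * S₁) ≈ sign N * (e z N * (A * H) + S₂) - S₃
      identity = begin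
        ½ * (A * S₁)
          ≈⟨ *-congˡ (trans (anti-cong n term₁) (anti-* n A (λ k m → e x k * r k * e y m))) ⟨
        ½ * anti n (λ k m → e x k * e y m * (l (suc k) - l k))
          ≈⟨ euler-reflected x+y+z≈1 l n ⟩
        -- The k = 0 terms are split off because the closed form covers only differences of order at
        -- least 1. The first of them yields H, the second is zero.
        sign N * (b y 0 * e z N * l N + anti n (λ k m → b y (suc k) * e z m * Δ (suc k) l m))
          - (sign N * (b x 0 * e z N * (A * (0# − 0#)))
              + anti n (λ k m → sign m * (b x (suc k) * e z m * Δ (suc k) l 0)))
          ≈⟨ +-cong (*-congˡ (+-cong (*-congʳ (*-congʳ (b-0 y))) (anti-cong n term₂)))
               (-‿cong (+-congˡ (anti-cong n term₃))) ⟩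
        sign N * (1# * e z N * (A * (H − 0#)) + S₂) - (sign N * (b x 0 * e z N * (A * (0# − 0#))) + S₃)
          ≈⟨ solve 7 (λ s e a h p q b → s :* (:1 :* e :* (a :* (h :- :0)) :+ p) :- (s :* (b :* e :* (a :* (:0 :- :0))) :+ q)
               := s :* (e :* (a :* h) :+ p) :- q) refl (sign N) (e z N) A H S₂ S₃ (b x 0) ⟩
        sign N * (e z N * (A * H) + S₂) - S₃ ∎

      euler-euler-reciprocal-sum :
        ι N * ½ * binom t N * (∑[ k ∈ 0 ⋯ n ] (choose n k * (eulerPoly k x * (t − ι k) ⁻¹) * eulerPoly (n ∸ k) y))
          − sign N * eulerPoly N z * binom t N * (∑[ k ∈ 0 ⋯ n ] ((t − ι k) ⁻¹))
        ≈ sign N * (∑[ k ∈ 1 ⋯ N ] (binom t (N ∸ k) * (bernoulliPoly k y * (ι k) ⁻¹) * eulerPoly (N ∸ k) z))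
          − (∑[ k ∈ 1 ⋯ N ] (binom (ι n − t) (N ∸ k) * (bernoulliPoly k x * (ι k) ⁻¹) * eulerPoly (N ∸ k) z))
      euler-euler-reciprocal-sum = begin
        ι N * ½ * binom t N * (∑[ k ∈ 0 ⋯ n ] (choose n k * (eulerPoly k x * (t − ι k) ⁻¹) * eulerPoly (n ∸ k) y))
          − sign N * eulerPoly N z * binom t N * H
          ≈⟨ +-cong (*-congˡ (choose-sum (e≈ x) (e≈ y) r n)) (-‿cong (*-congʳ (*-congʳ (*-congˡ (e≈ z N))))) ⟩
        ι N * ½ * binom t N * (ι (n !) * S₁) − sign N * (ι (N !) * e z N) * binom t N * H
          ≈⟨ solve 9 (λ i h B f p s g e H → i :* h :* B :* (f :* p) :- s :* (g :* e) :* B :* H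
               := h :* (B :* (i :* f) :* p) :- s :* (e :* (B :* g :* H)))
               refl (ι N) ½ (binom t N) (ι (n !)) S₁ (sign N) (ι (N !)) (e z N) H ⟩
        ½ * (binom t N * (ι N * ι (n !)) * S₁) − sign N * (e z N * (binom t N * ι (N !) * H))
          ≈⟨ +-cong (*-congˡ (*-congʳ (trans (*-congˡ (sym (ι-* N (n !)))) (binom-falling t N))))
               (-‿cong (*-congˡ (*-congˡ (*-congʳ (binom-falling t N))))) ⟩
        ½ * (A * S₁) − sign N * (e z N * (A * H))
          ≈⟨ +-congʳ identity ⟩
        sign N * (e z N * (A * H) + S₂) - S₃ − sign N * (e z N * (A * H))
          ≈⟨ solve 4 (λ s u p q → s :* (u :+ p) :- q :- s :* u := s :* p :- q) refl (sign N) _ S₂ S₃ ⟩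
        sign N * S₂ − S₃
          ≈⟨ +-cong (*-congˡ (quotient-sum (b≈ y) (e≈ z) t n)) (-‿cong (quotient-sum (b≈ x) (e≈ z) (ι n − t) n)) ⟨
        sign N * (∑[ k ∈ 1 ⋯ N ] (binom t (N ∸ k) * (bernoulliPoly k y * (ι k) ⁻¹) * eulerPoly (N ∸ k) z))
          − (∑[ k ∈ 1 ⋯ N ] (binom (ι n − t) (N ∸ k) * (bernoulliPoly k x * (ι k) ⁻¹) * eulerPoly (N ∸ k) z)) ∎

    module HarmonicBernoulli (n : ℕ) (t≉ : ∀ k → k ≤ suc n → ¬ (t ≈ ι k)) where
      N : ℕ
      N = suc n
      A f d H S₁ S₂ S₃ : Carrier
      A = falling t (suc N)
      f = falling (t − 1#) n
      d = ι N − t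
      H = sumCount 1 n r
      S₁ = anti N (λ k m → b x k * r k * b y m)
      S₂ = anti n (λ k m → ι (k !) * falling t m * (b y (suc k) * b z m))
      S₃ = anti n (λ k m → ι (k !) * falling (ι N − t) m * (b x (suc k) * b z m))
      l : Series
      -- The differences in the sum over `b x` are now taken at 1, so h is the partial sum there, as
      -- `sumCount 0 1 r` unfolds; l N then retains the harmonic sum from k = 1 on. The length is N
      -- + 1 because the left-hand side reaches 1/(t - N).
      l = harmonicWeight t (suc N) (r 0 + 0#)
      t≉′ : ∀ k → k < suc N → ¬ (t ≈ ι k)
      t≉′ k (s≤s k≤N) = t≉ k k≤N

      term₁ : ∀ k m → k ℕ.+ m ≡ N → b x k * b y m * (l (suc k) - l k) ≈ A * (b x k * r k * b y m)
      term₁ k m _ = trans (*-congˡ (harmonicWeight-step t (suc N) (r 0 + 0#) k))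
        (solve 4 (λ x y a r → x :* y :* (a :* r) := a :* (x :* r :* y)) refl (b x k) (b y m) A (r k))

      term₂ : ∀ k m → k ℕ.+ m ≡ n → b y (suc k) * b z m * Δ (suc k) l m ≈
        (t − ι N) * (ι (k !) * falling t m * (b y (suc k) * b z m))
      term₂ k m eq = begin
        b y (suc k) * b z m * Δ (suc k) l m
          -- The product of length N + 1 has one factor to spare beyond the block removed and
          -- `falling t m`: the last one, t - N.
          ≈⟨ *-congˡ (Δ-harmonicWeight t (suc N) (r 0 + 0#) t≉′ k m 1
               (≡.cong suc (≡.trans (≡.cong (k ℕ.+_) (ℕ.+-comm m 1)) (≡.trans (ℕ.+-suc k m) (≡.cong suc eq))))) ⟩
        b y (suc k) * b z m * (ι (k !) * falling t m * falling (t − ι (suc (m ℕ.+ k))) 1)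
          ≈⟨ *-congˡ (*-congˡ (trans (falling-1 _)
               (reflexive (≡.cong (λ i → t − ι (suc i)) (≡.trans (ℕ.+-comm m k) eq))))) ⟩
        b y (suc k) * b z m * (ι (k !) * falling t m * (t − ι N))
          ≈⟨ solve 4 (λ p a f τ → p :* (a :* f :* τ) := τ :* (a :* f :* p)) refl _ (ι (k !)) (falling t m) (t − ι N) ⟩
        (t − ι N) * (ι (k !) * falling t m * (b y (suc k) * b z m)) ∎

      term₃ : ∀ k m → k ℕ.+ m ≡ n → sign m * (b x (suc k) * b z m * Δ (suc k) l 1) ≈
        t * (ι (k !) * falling (ι N − t) m * (b x (suc k) * b z m))
      term₃ k m eq = begin
        sign m * (b x (suc k) * b z m * Δ (suc k) l 1)
          -- With base point 1 the factor to spare is the first one, t.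
          ≈⟨ *-congˡ (*-congˡ (Δ-harmonicWeight t (suc N) (r 0 + 0#) t≉′ k 1 m
               (≡.cong suc (≡.trans (ℕ.+-suc k m) (≡.cong suc eq))))) ⟩
        sign m * (b x (suc k) * b z m * (ι (k !) * falling t 1 * falling (t − ι (suc (suc k))) m))
          ≈⟨ *-congˡ (*-congˡ (*-congʳ (*-congˡ (falling-1 t)))) ⟩
        sign m * (b x (suc k) * b z m * (ι (k !) * t * falling (t − ι (suc (suc k))) m))
          ≈⟨ solve 5 (λ s p a t f → s :* (p :* (a :* t :* f)) := t :* (a :* (s :* f) :* p))
               refl (sign m) (b x (suc k) * b z m) (ι (k !)) t (falling (t − ι (suc (suc k))) m) ⟩
        t * (ι (k !) * (sign m * falling (t − ι (suc (suc k))) m) * (b x (suc k) * b z m))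
          ≈⟨ *-congˡ (*-congʳ (*-congˡ (sign-falling m (ι N − t) argument))) ⟩
        t * (ι (k !) * falling (ι N − t) m * (b x (suc k) * b z m)) ∎
        where
        argument : ι m − 1# − (t − ι (suc (suc k))) ≈ ι N − t
        argument = begin
          ι m − 1# − (t − (1# + (1# + ι k)))
            ≈⟨ solve 3 (λ k m t → m :- :1 :- (t :- (:1 :+ (:1 :+ k))) := :1 :+ (k :+ m) :- t) refl (ι k) (ι m) t ⟩
          1# + (ι k + ι m) − t        ≈⟨ +-congʳ (+-congˡ (ι-+ k m)) ⟨
          1# + ι (k ℕ.+ m) − t        ≡⟨ ≡.cong (λ i → 1# + ι i − t) eq ⟩
          ι N − t                     ∎

      A≈ : A ≈ t * f * (t − ι N)
      A≈ = *-congʳ (falling-suc t n)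

      identity : t * f * (t − ι N) * S₁ ≈
        t * S₃ - sign N * (b z N * (t * f * (t − ι N) * H) + (t − ι N) * S₂)
      identity = begin
        t * f * (t − ι N) * S₁
          ≈⟨ *-congʳ A≈ ⟨
        A * S₁
          ≈⟨ trans (anti-cong N term₁) (anti-* N A (λ k m → b x k * r k * b y m)) ⟨
        anti N (λ k m → b x k * b y m * (l (suc k) - l k))
          ≈⟨ bernoulli-reflected x+y+z≈1 l N ⟩
        (sign N * (b x 0 * b z N * (A * (r 0 + 0# − (r 0 + 0#))))
            + anti n (λ k m → sign m * (b x (suc k) * b z m * Δ (suc k) l 1)))
          - sign N * (b y 0 * b z N * l N + anti n (λ k m → b y (suc k) * b z m * Δ (suc k) l m))
          ≈⟨ +-cong (+-congˡ (trans (anti-cong n term₃)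
                 (anti-* n t (λ k m → ι (k !) * falling (ι N − t) m * (b x (suc k) * b z m)))))
               (-‿cong (*-congˡ (+-cong (*-congʳ (*-congʳ (b-0 y))) (trans (anti-cong n term₂)
                 (anti-* n (t − ι N) (λ k m → ι (k !) * falling t m * (b y (suc k) * b z m))))))) ⟩
        (sign N * (b x 0 * b z N * (A * (r 0 + 0# − (r 0 + 0#)))) + t * S₃)
          - sign N * (1# * b z N * (A * (r 0 + H − (r 0 + 0#))) + (t − ι N) * S₂)
          ≈⟨ solve 8 (λ s β b a r h p q → (s :* (β :* b :* (a :* (r :+ :0 :- (r :+ :0)))) :+ p)
                 :- s :* (:1 :* b :* (a :* (r :+ h :- (r :+ :0))) :+ q)
               := p :- s :* (b :* (a :* h) :+ q)) refl (sign N) (b x 0) (b z N) A (r 0) H (t * S₃) ((t − ι N) * S₂) ⟩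
        t * S₃ - sign N * (b z N * (A * H) + (t − ι N) * S₂)
          ≈⟨ +-congˡ (-‿cong (*-congˡ (+-congʳ (*-congˡ (*-congʳ A≈))))) ⟩
        t * S₃ - sign N * (b z N * (t * f * (t − ι N) * H) + (t − ι N) * S₂) ∎

      prefactor : ι N ⁻¹ * binom (t − 1#) n * ι (N !) ≈ f
      prefactor = begin
        ι N ⁻¹ * (f * invFact n) * ι (N !)
          ≈⟨ *-congˡ (ι-* N (n !)) ⟩
        ι N ⁻¹ * (f * invFact n) * (ι N * ι (n !))
          ≈⟨ solve 5 (λ j f i N n → j :* (f :* i) :* (N :* n) := N :* j :* (n :* i :* f)) refl (ι N ⁻¹) f (invFact n) (ι N) (ι (n !)) ⟩
        ι N * ι N ⁻¹ * (ι (n !) * invFact n * f)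
          ≈⟨ trans (insert (!-invFact n) f) (insert (⁻¹-inverse _ (charZero n)) _) ⟨
        f ∎

      bernoulli-bernoulli-reciprocal-sum :
        sign n * (ι N) ⁻¹ * binom (t − 1#) n * (∑[ k ∈ 0 ⋯ N ] (choose N k * (bernoulliPoly k x * (t − ι k) ⁻¹) * bernoulliPoly (N ∸ k) y))
          − bernoulliPoly N z * (ι N) ⁻¹ * binom (t − 1#) n * (∑[ k ∈ 1 ⋯ n ] ((t − ι k) ⁻¹))
        ≈ t ⁻¹ * (∑[ k ∈ 1 ⋯ N ] (binom t (N ∸ k) * (bernoulliPoly k y * (ι k) ⁻¹) * bernoulliPoly (N ∸ k) z))
          + sign N * (ι N − t) ⁻¹ * (∑[ k ∈ 1 ⋯ N ] (binom (ι N − t) (N ∸ k) * (bernoulliPoly k x * (ι k) ⁻¹) * bernoulliPoly (N ∸ k) z))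
      bernoulli-bernoulli-reciprocal-sum = begin
        sign n * (ι N) ⁻¹ * binom (t − 1#) n * (∑[ k ∈ 0 ⋯ N ] (choose N k * (bernoulliPoly k x * (t − ι k) ⁻¹) * bernoulliPoly (N ∸ k) y))
          − bernoulliPoly N z * (ι N) ⁻¹ * binom (t − 1#) n * H
          ≈⟨ +-cong (*-congˡ (choose-sum (b≈ x) (b≈ y) r N)) (-‿cong (*-congʳ (*-congʳ (*-congʳ (b≈ z N))))) ⟩
        sign n * (ι N) ⁻¹ * binom (t − 1#) n * (ι (N !) * S₁) − ι (N !) * b z N * (ι N) ⁻¹ * binom (t − 1#) n * H
          ≈⟨ solve 7 (λ s j B g p b h → s :* j :* B :* (g :* p) :- g :* b :* j :* B :* h
               := j :* B :* g :* (s :* p :- b :* h)) refl (sign n) (ι N ⁻¹) (binom (t − 1#) n) (ι (N !)) S₁ (b z N) H ⟩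
        ι N ⁻¹ * binom (t − 1#) n * ι (N !) * (sign n * S₁ − b z N * H)
          ≈⟨ *-congʳ prefactor ⟩
        f * (sign n * S₁ − b z N * H)
          -- In `identity` S₂ comes with t - N and S₃ with t, so cancelling the product of t and d
          -- leaves 1/t at S₂ and 1/(N - t) at S₃.
          ≈⟨ *-cancelˡ t≉0 (*-cancelˡ d≉0 cleared) ⟩
        t ⁻¹ * S₂ + sign N * d ⁻¹ * S₃
          ≈⟨ +-cong (*-congˡ (quotient-sum (b≈ y) (b≈ z) t n)) (*-congˡ (quotient-sum (b≈ x) (b≈ z) (ι N − t) n)) ⟨
        t ⁻¹ * (∑[ k ∈ 1 ⋯ N ] (binom t (N ∸ k) * (bernoulliPoly k y * (ι k) ⁻¹) * bernoulliPoly (N ∸ k) z))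
          + sign N * d ⁻¹ * (∑[ k ∈ 1 ⋯ N ] (binom (ι N − t) (N ∸ k) * (bernoulliPoly k x * (ι k) ⁻¹) * bernoulliPoly (N ∸ k) z)) ∎
        where
        t≉0 : ¬ (t ≈ 0#)
        t≉0 = t≉ 0 z≤n
        d≉0 : ¬ (d ≈ 0#)
        d≉0 = −-nonZero (λ N≈t → t≉ N ℕ.≤-refl (sym N≈t))
        cleared : d * (t * (f * (sign n * S₁ − b z N * H))) ≈ d * (t * (t ⁻¹ * S₂ + sign N * d ⁻¹ * S₃))
        cleared = begin
          d * (t * (f * (sign n * S₁ − b z N * H)))
            ≈⟨ solve 7 (λ N t f s p b h → (N :- t) :* (t :* (f :* (s :* p :- b :* h)))
                 := (:- :1) :* s :* (t :* f :* (t :- N) :* p) :- (N :- t) :* (t :* (f :* (b :* h)))) refl (ι N) t f (sign n) S₁ (b z N) H ⟩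
          sign N * (t * f * (t − ι N) * S₁) − d * (t * (f * (b z N * H)))
            ≈⟨ +-congʳ (*-congˡ identity) ⟩
          sign N * (t * S₃ - sign N * (b z N * (t * f * (t − ι N) * H) + (t − ι N) * S₂)) − d * (t * (f * (b z N * H)))
            ≈⟨ solve 4 (λ s p q w → s :* (p :- s :* q) :- w := s :* p :- s :* s :* q :- w)
                 refl (sign N) (t * S₃) (b z N * (t * f * (t − ι N) * H) + (t − ι N) * S₂) (d * (t * (f * (b z N * H)))) ⟩
          sign N * (t * S₃) - sign N * sign N * (b z N * (t * f * (t − ι N) * H) + (t − ι N) * S₂) − d * (t * (f * (b z N * H)))
            ≈⟨ +-congʳ (+-congˡ (-‿cong (insert (sign-square N) _))) ⟨
          sign N * (t * S₃) - (b z N * (t * f * (t − ι N) * H) + (t − ι N) * S₂) − d * (t * (f * (b z N * H)))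
            ≈⟨ solve 7 (λ u b t f N h p → u :- (b :* (t :* f :* (t :- N) :* h) :+ (t :- N) :* p) :- (N :- t) :* (t :* (f :* (b :* h)))
                 := (N :- t) :* p :+ u) refl (sign N * (t * S₃)) (b z N) t f (ι N) H S₂ ⟩
          d * S₂ + sign N * (t * S₃)
            ≈⟨ +-cong (insert (⁻¹-inverse t t≉0) _) (insert (⁻¹-inverse d d≉0) _) ⟩
          t * t ⁻¹ * (d * S₂) + d * d ⁻¹ * (sign N * (t * S₃))
            ≈⟨ solve 7 (λ t i d p j s q → t :* i :* (d :* p) :+ d :* j :* (s :* (t :* q)) := d :* (t :* (i :* p :+ s :* j :* q)))
                 refl t (t ⁻¹) d S₂ (d ⁻¹) (sign N) S₃ ⟩
          d * (t * (t ⁻¹ * S₂ + sign N * d ⁻¹ * S₃)) ∎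

theorem1p3 : {c ℓ : Level} (F : CharZeroField c ℓ) →
  let open CharZeroField F
      open FieldDefs F
  in (n : ℕ) → 1 ≤ n → (x y z t : Carrier) → x + y + z ≈ 1# →
     ((∀ k → k ≤ n → ¬ (t ≈ ι k)) →
       sign n * ½ * (∑[ k ∈ 0 ⋯ n ∸ 1 ] (binom t k * eulerPoly k x * eulerPoly (n ∸ 1 ∸ k) y))
       ≈ (ι n − t) ⁻¹ * (∑[ k ∈ 0 ⋯ n ] (binom (ι n − t) k * bernoulliPoly k x * eulerPoly (n ∸ k) z))
         + binom t n * (∑[ k ∈ 0 ⋯ n ] (choose n k * (eulerPoly k z * (t − ι k) ⁻¹) * bernoulliPoly (n ∸ k) y)))
     × ((∀ k → k < n → ¬ (t ≈ ι k)) →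
       ι n * ½ * binom t n * (∑[ k ∈ 0 ⋯ n ∸ 1 ] (choose (n ∸ 1) k * (eulerPoly k x * (t − ι k) ⁻¹) * eulerPoly (n ∸ 1 ∸ k) y))
         − sign n * eulerPoly n z * binom t n * (∑[ k ∈ 0 ⋯ n ∸ 1 ] ((t − ι k) ⁻¹))
       ≈ sign n * (∑[ k ∈ 1 ⋯ n ] (binom t (n ∸ k) * (bernoulliPoly k y * (ι k) ⁻¹) * eulerPoly (n ∸ k) z))
         − (∑[ k ∈ 1 ⋯ n ] (binom (ι (n ∸ 1) − t) (n ∸ k) * (bernoulliPoly k x * (ι k) ⁻¹) * eulerPoly (n ∸ k) z)))
     × ((∀ k → k ≤ n → ¬ (t ≈ ι k)) →
       sign (n ∸ 1) * (ι n) ⁻¹ * binom (t − 1#) (n ∸ 1) * (∑[ k ∈ 0 ⋯ n ] (choose n k * (bernoulliPoly k x * (t − ι k) ⁻¹) * bernoulliPoly (n ∸ k) y))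
         − bernoulliPoly n z * (ι n) ⁻¹ * binom (t − 1#) (n ∸ 1) * (∑[ k ∈ 1 ⋯ n ∸ 1 ] ((t − ι k) ⁻¹))
       ≈ t ⁻¹ * (∑[ k ∈ 1 ⋯ n ] (binom t (n ∸ k) * (bernoulliPoly k y * (ι k) ⁻¹) * bernoulliPoly (n ∸ k) z))
         + sign n * (ι n − t) ⁻¹ * (∑[ k ∈ 1 ⋯ n ] (binom (ι n − t) (n ∸ k) * (bernoulliPoly k x * (ι k) ⁻¹) * bernoulliPoly (n ∸ k) z)))
-- At `suc n` every predecessor in the statement reduces to the index n of the modules.
theorem1p3 F (suc n) _ x y z t x+y+z≈1 =
  Factorial.euler-euler-sum t x+y+z≈1 n
  , HarmonicEuler.euler-euler-reciprocal-sum t x+y+z≈1 n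
  , HarmonicBernoulli.bernoulli-bernoulli-reciprocal-sum t x+y+z≈1 n
  where open SunPan F
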